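{- Let $n\ge 2$ and let $\pi,\sigma\in\mathfrak{B}_n$ have respective length vectors $(\ell_1,\ell_2,\ell_3,\ell_4)$ and $(m_1,m_2,m_3,m_4)$. Then the distance between $\pi$ and $\sigma$ in the Hasse diagram of $(\mathfrak{B}_n,\le)$ is $$\max\{|\ell_1-m_1|+|\ell_4-m_4|,\ |\ell_2-m_2|+|\ell_3-m_3|\}.$$ In particular, the Hasse diagram of $\mathfrak{B}_n$ is connected.
   Context: $\mathfrak{S}_n$ is the set of permutations of $[n]=\{1,\dots,n\}$, in one-line notation. A reduction of $\omega\in\mathfrak{S}_n$ interchanges $\omega(i)$ and $\omega(j)$ for some $i<j$ with $\omega(i)>\omega(j)$. Bruhat order: $\pi\le\sigma$ if $\pi$ is obtained from $\sigma$ by a (possibly empty) sequence of reductions. $\mathfrak{B}_n\subseteq\mathfrak{S}_n$ is the set of bigrassmannian permutations (both $\omega$ and $\omega^{ -1}$ have exactly one descent), with the order inherited from Bruhat order; equivalently $\omega=1\cdots a\,(b+1)\cdots c\,(a+1)\cdots b\,(c+1)\cdots n$ for a unique triple $0\le a<b<c\le n$. The length vector of such an element is $(\ell_1,\ell_2,\ell_3,\ell_4)=(a+1,b-a,c-b,n+1-c)$. The Hasse diagram is the undirected graph on $\mathfrak{B}_n$ whose edges join pairs in which one element covers the other in the poset $(\mathfrak{B}_n,\le)$; distance is the number of edges in a shortest walk. -}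

module Defs where

open import Data.Nat using (ℕ; zero; suc; _+_; _∸_)
import Data.Nat as ℕ
open import Data.Fin using (Fin; toℕ)
import Data.Fin as Fin
open import Data.Fin.Permutation
  using (Permutation′; _⟨$⟩ʳ_; _≈_; _∘ₚ_; transpose; flip)
open import Data.List using (List; _++_; applyUpTo; tabulate)
open import Data.Product using (∃; ∃!; ∃₂; _×_; proj₁)
open import Data.Sum using (_⊎_)
open import Function using (_on_)
open import Level using (0ℓ)
open import Relation.Binary using (Rel)
open import Relation.Binary.Construct.Closure.ReflexiveTransitive using (Star)
import Relation.Binary.Construct.NonStrictToStrict as ToStrict
open import Relation.Binary.PropositionalEquality using (_≡_)
open import Relation.Nullary using (¬_)

private
  variable
    n : ℕ

-- `transpose i j ∘ₚ σ` applies the transposition first, so it interchanges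
-- the entries of the one-line notation of σ in positions i and j.
Reduction : Rel (Permutation′ n) 0ℓ
Reduction σ τ = ∃₂ λ i j →
  i Fin.< j × (σ ⟨$⟩ʳ i) Fin.> (σ ⟨$⟩ʳ j) × τ ≈ transpose i j ∘ₚ σ

-- Bruhat order.  Permutations are identified up to pointwise equality _≈_,
-- hence the final comparison after the sequence of reductions.
infix 4 _≤ᴮ_
_≤ᴮ_ : Rel (Permutation′ n) 0ℓ
π ≤ᴮ σ = ∃ λ τ → Star Reduction σ τ × τ ≈ π

-- The descent between positions i and i + 1.
Descent : Permutation′ n → Fin n → Set
Descent ω i = ∃ λ j → toℕ j ≡ suc (toℕ i) × (ω ⟨$⟩ʳ i) Fin.> (ω ⟨$⟩ʳ j)

Bigrassmannian : Permutation′ n → Set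
Bigrassmannian ω = ∃! _≡_ (Descent ω) × ∃! _≡_ (Descent (flip ω))

𝔅 : ℕ → Set
𝔅 n = ∃ (Bigrassmannian {n})

infix 4 _≈𝔅_ _≤𝔅_
_≈𝔅_ : Rel (𝔅 n) 0ℓ
_≈𝔅_ = _≈_ on proj₁

_≤𝔅_ : Rel (𝔅 n) 0ℓ
_≤𝔅_ = _≤ᴮ_ on proj₁

infix 4 _<𝔅_ _⋖_
_<𝔅_ : Rel (𝔅 n) 0ℓ
_<𝔅_ = ToStrict._<_ _≈𝔅_ _≤𝔅_

-- The covering relation of the poset 𝔅 n, not that of the symmetric group.
_⋖_ : Rel (𝔅 n) 0ℓ
π ⋖ σ = π <𝔅 σ × ¬ (∃ λ ρ → π <𝔅 ρ × ρ <𝔅 σ)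

HasseEdge : Rel (𝔅 n) 0ℓ
HasseEdge π σ = π ⋖ σ ⊎ σ ⋖ π

-- Walks in the Hasse diagram, indexed by their number of edges.
data Walk {n : ℕ} : ℕ → Rel (𝔅 n) 0ℓ where
  stop : ∀ {π σ} → π ≈𝔅 σ → Walk zero π σ
  step : ∀ {k π ρ σ} → HasseEdge π ρ → Walk k ρ σ → Walk (suc k) π σ

IsDistance : 𝔅 n → 𝔅 n → ℕ → Set
IsDistance π σ d = Walk d π σ × (∀ k → Walk k π σ → d ℕ.≤ k)

HasseConnected : ℕ → Set
HasseConnected n = 𝔅 n × (∀ (π σ : 𝔅 n) → ∃ λ k → Walk k π σ)

-- One-line notation with the values 1, …, n, where Fin n counts from 0.
oneLine : Permutation′ n → List ℕ
oneLine ω = tabulate λ i → suc (toℕ (ω ⟨$⟩ʳ i))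

-- The list p, p + 1, …, q, which is empty if q < p.
infix 6 _⋯_
_⋯_ : ℕ → ℕ → List ℕ
p ⋯ q = applyUpTo (p +_) (suc q ∸ p)

HasLengthVector : 𝔅 n → (ℓ₁ ℓ₂ ℓ₃ ℓ₄ : ℕ) → Set
HasLengthVector {n} π ℓ₁ ℓ₂ ℓ₃ ℓ₄ = ∃ λ a → ∃ λ b → ∃ λ c →
  a ℕ.< b × b ℕ.< c × c ℕ.≤ n ×
  oneLine (proj₁ π) ≡ 1 ⋯ a ++ suc b ⋯ c ++ suc a ⋯ b ++ suc c ⋯ n ×
  ℓ₁ ≡ suc a × ℓ₂ ≡ b ∸ a × ℓ₃ ≡ c ∸ b × ℓ₄ ≡ suc n ∸ c

{-# OPTIONS --safe #-}
-- A bigrassmannian permutation exchanges two adjacent blocks of positions, so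
-- it is given by its length vector ℓ, and ℓ - (1, 1, 1, 1) splits into an outer
-- pair o = (ℓ₁ - 1, ℓ₄ - 1) and an inner pair i = (ℓ₂ - 1, ℓ₃ - 1) with constant
-- total sum. Going down in Bruhat order means that o increases and i decreases
-- componentwise: bounds such as σ(k) ≤ k + p survive reductions and give one
-- direction, and sliding one entry past the adjacent block gives the other. So
-- a covering changes one entry of o and one entry of i by 1, in opposite
-- directions. The distance is therefore at least the ℓ¹ distance in each of o
-- and i, and a walk that takes needed moves in both pairs attains the maximum.
module Submission where

open import Algebra.Properties.CommutativeSemigroup using (interchange; xy∙z≈xz∙y)
open import Data.Empty using (⊥; ⊥-elim)
open import Data.Fin using (Fin; toℕ; fromℕ<)
import Data.Fin as Fin
open import Data.Fin.Permutation
  using (Permutation′; permutation; _⟨$⟩ʳ_; _⟨$⟩ˡ_; _≈_; _∘ₚ_; transpose; flip;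
    inverseˡ; inverseʳ)
import Data.Fin.Permutation.Components as PC
open import Data.Fin.Properties using (toℕ<n; toℕ-fromℕ<; fromℕ<-toℕ; toℕ-injective)
import Data.Fin.Properties as Fin
open import Data.List using (List; []; _∷_; _++_; applyUpTo; tabulate)
open import Data.List.Properties using (++-identityʳ)
open import Data.Nat
open import Data.Nat.Properties
open import Data.Nat.Tactic.RingSolver using (solve)
open import Data.Product using (∃; ∃₂; ∃!; _×_; _,_; proj₁; proj₂)
open import Data.Sum using (_⊎_; inj₁; inj₂)
open import Defs
open import Function using (_∘_)
open import Relation.Binary using (tri<; tri≈; tri>)
open import Relation.Binary.Construct.Closure.ReflexiveTransitive using (ε; _◅_; _◅◅_; gmap)
open import Relation.Binary.PropositionalEquality
open import Relation.Nullary using (¬_; Dec; yes; no; contradiction)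

private
  variable
    n : ℕ

-- Inversion of permutations keeps the start `a` and the end `a + p + q` of the two blocks,
-- exchanges their sizes and preserves Bruhat order. Hence two of the four unit moves, and the
-- comparison of the second block size, come from the others through `flip`. Since the elements are
-- given by their descents, the block form itself has to be derived: a permutation and its inverse
-- each rise on both sides of a single fall, and what one does on either side pins down the other.
-- The constant total enters three times: it turns a bound on the end of the blocks into one on the
-- last outer entry, it leaves no room inside a unit move, and it supplies the balance between
-- needed increments and decrements on which the walk depends.

+-swapʳ : ∀ m n o → m + n + o ≡ m + o + n
+-swapʳ = xy∙z≈xz∙y +-commutativeSemigroup

+-interchange : ∀ m n o p → m + n + (o + p) ≡ m + o + (n + p)
+-interchange = interchange +-commutativeSemigroup

-- Linear arithmetic: a consequence of inequalities is obtained by adding them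
-- with _⊕_ and leaving an equation to the ring solver.

infixr 5 _⊕_
_⊕_ : ∀ {a b c d} → a ≤ b → c ≤ d → a + c ≤ b + d
_⊕_ = +-mono-≤

≤-by : ∀ {a b x y} → a ≤ b → x + b ≡ y + a → x ≤ y
≤-by {a} {b} {x} {y} a≤b e =
  +-cancelʳ-≤ b x y (≤-trans (≤-reflexive e) (+-monoʳ-≤ y a≤b))

⊥-by : ∀ {a b} x → a ≤ b → a ≡ suc (x + b) → ⊥
⊥-by {a} {b} x a≤b e = m+1+n≰m b
  (≤-trans (≤-reflexive (trans (+-suc b x) (trans (cong suc (+-comm b x)) (sym e)))) a≤b)

≤⇒+ : ∀ {m n} → m ≤ n → ∃ λ k → n ≡ m + k
≤⇒+ {m} m≤n = _ , sym (m+[n∸m]≡n m≤n)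

-- The graph of 1 ⋯ a, b + 1 ⋯ c, a + 1 ⋯ b, c + 1 ⋯ (0-indexed) with
-- b = a + p and c = a + p + q: the block of q positions from a on moves up by
-- p and the next block of p positions moves down by q.
data Swap (a p q : ℕ) : ℕ → ℕ → Set where
  left   : ∀ {i} → i < a → Swap a p q i i
  up     : ∀ {j} → j < q → Swap a p q (a + j) (a + p + j)
  down   : ∀ {j} → j < p → Swap a p q (a + q + j) (a + j)
  right  : ∀ {i} → a + p + q ≤ i → Swap a p q i i

-- The function yields the permutation, whereas matching on the relation `Swap` exposes the offset
-- `j` inside a block; with both at hand, later arguments avoid truncated subtraction.
blockSwap : (a p q : ℕ) → ℕ → ℕ
blockSwap a p q i with i <? a | i <? a + q | i <? a + p + q
... | yes _ | _     | _     = i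
... | no _  | yes _ | _     = i + p
... | no _  | no _  | yes _ = i ∸ q
... | no _  | no _  | no _  = i

swap-to : ∀ {a p q i v v′} → Swap a p q i v → v ≡ v′ → Swap a p q i v′
swap-to s refl = s

shift-back : ∀ a q j → a + q + j ∸ q ≡ a + j
shift-back a q j = trans (cong (_∸ q) (+-swapʳ a q j)) (m+n∸n≡m (a + j) q)

swap-blockSwap : ∀ a p q i → Swap a p q i (blockSwap a p q i)
swap-blockSwap a p q i with i <? a | i <? a + q | i <? a + p + q
... | yes i<a | _ | _ = left i<a
... | no i≮a  | yes i<a+q | _ with j , refl ← ≤⇒+ (≮⇒≥ i≮a) =
  swap-to (up (+-cancelˡ-< a j q i<a+q)) (sym (+-swapʳ a j p))
... | no _ | no i≮a+q  | yes i<c with j , refl ← ≤⇒+ (≮⇒≥ i≮a+q) =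
  swap-to (down (≤-by i<c (solve (a ∷ p ∷ q ∷ j ∷ [])))) (sym (shift-back a q j))
... | no _  | no _  | no i≮c = right (≮⇒≥ i≮c)

swap⇒≡ : ∀ {a p q i v} → Swap a p q i v → blockSwap a p q i ≡ v
swap⇒≡ {a} {p} {q} {i} s with i <? a | i <? a + q | i <? a + p + q | s
... | yes _ | _ | _ | left _ = refl
... | yes a+j<a | _ | _ | up {j} _ = ⊥-elim (⊥-by j a+j<a (solve (a ∷ j ∷ [])))
... | yes i<a | _ | _ | down {j} _ = ⊥-elim (⊥-by (q + j) i<a (solve (a ∷ q ∷ j ∷ [])))
... | yes _ | _ | _ | right _ = refl
... | no i≮a | _ | _ | left i<a = contradiction i<a i≮a
... | no _ | yes _ | _ | up {j} _ = +-swapʳ a j p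
... | no _ | yes i<a+q | _ | down {j} _ = ⊥-elim (⊥-by j i<a+q (solve (a ∷ q ∷ j ∷ [])))
... | no _ | yes i<a+q | _ | right c≤i =
  ⊥-elim (⊥-by p (i<a+q ⊕ c≤i) (solve (a ∷ p ∷ q ∷ i ∷ [])))
... | no _ | no i≮a+q | _ | up j<q = contradiction (+-monoʳ-< a j<q) i≮a+q
... | no _ | no _ | yes _ | down {j} _ =
  shift-back a q j
... | no _ | no _ | yes i<c | right c≤i = contradiction i<c (≤⇒≯ c≤i)
... | no _ | no _ | no i≮c | down {j} j<p =
  ⊥-elim (i≮c (≤-by j<p (solve (a ∷ p ∷ q ∷ j ∷ []))))
... | no _ | no _ | no _ | right _ = refl

swap-sym : ∀ {a p q i v} → Swap a p q i v → Swap a q p v i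
swap-sym (left i<a) = left i<a
swap-sym (up j<q) = down j<q
swap-sym (down j<p) = up j<p
swap-sym {a} {p} {q} (right c≤i) = right (≤-by c≤i (solve (a ∷ p ∷ q ∷ [])))

blockSwap-inverse : ∀ a p q i → blockSwap a p q (blockSwap a q p i) ≡ i
blockSwap-inverse a p q i = swap⇒≡ (swap-sym (swap-blockSwap a q p i))

swap-< : ∀ {a p q n i v} → a + p + q ≤ n → i < n → Swap a p q i v → v < n
swap-< c≤n i<n (left _) = i<n
swap-< {a} {p} {q} {n} c≤n i<n (up {j} j<q) = ≤-by (c≤n ⊕ j<q) (solve (a ∷ p ∷ q ∷ n ∷ j ∷ []))
swap-< {a} {p} {q} {n} c≤n i<n (down {j} j<p) =
  ≤-by (i<n ⊕ z≤n {q}) (solve (a ∷ q ∷ n ∷ j ∷ []))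
swap-< c≤n i<n (right _) = i<n

-- Sequences with a single descent and their block form

record OneDescent (f : ℕ → ℕ) (d : ℕ) : Set where
  constructor oneDescent
  field
    falls : f (suc d) < f d
    rises : ∀ i → i ≢ d → f i < f (suc i)

OneDescent-cong : ∀ {f g d} → f ≗ g → OneDescent g d → OneDescent f d
OneDescent-cong f≗g (oneDescent falls rises) = oneDescent
  (subst₂ _<_ (sym (f≗g _)) (sym (f≗g _)) falls)
  (λ i i≢d → subst₂ _<_ (sym (f≗g _)) (sym (f≗g _)) (rises i i≢d))

blockSwap-rises : ∀ a y z i → i ≢ a + z →
  blockSwap a (suc y) (suc z) i < blockSwap a (suc y) (suc z) (suc i)
blockSwap-rises a y z i i≢d = go i≢d (swap-blockSwap a (suc y) (suc z) i)
  where
  next : ∀ i v {k u} → k ≡ suc i → Swap a (suc y) (suc z) k u → v < u →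
    v < blockSwap a (suc y) (suc z) (suc i)
  next i v refl s v<u = subst (v <_) (sym (swap⇒≡ s)) v<u
  go : ∀ {i v} → i ≢ a + z → Swap a (suc y) (suc z) i v → v < blockSwap a (suc y) (suc z) (suc i)
  go _ (left {i} i<a) with m≤n⇒m<n∨m≡n i<a
  ... | inj₁ i+1<a = next i i refl (left i+1<a) ≤-refl
  ... | inj₂ refl = next i i (cong suc (+-identityʳ i)) (up {j = 0} z<s)
    (≤-by (z≤n {suc y}) (solve (i ∷ y ∷ [])))
  go i≢d (up {j} j<q) with m≤n⇒m<n∨m≡n j<q
  ... | inj₁ j+1<q = next (a + j) (a + suc y + j) (+-suc a j) (up j+1<q)
    (≤-reflexive (sym (+-suc (a + suc y) j)))
  ... | inj₂ refl = contradiction refl i≢d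
  go _ (down {j} j<p) with m≤n⇒m<n∨m≡n j<p
  ... | inj₁ j+1<p = next (a + suc z + j) (a + j) (+-suc (a + suc z) j) (down j+1<p)
    (≤-reflexive (sym (+-suc a j)))
  ... | inj₂ refl = next (a + suc z + j) (a + j) refl
    (right (≤-reflexive (solve (a ∷ z ∷ j ∷ []))))
    (≤-by (z≤n {suc z}) (solve (a ∷ z ∷ j ∷ [])))
  go _ (right {i} c≤i) = next i i refl (right (m≤n⇒m≤1+n c≤i)) ≤-refl

-- The fall is at the last position of the block moving up, whose largest value is followed by `a`,
-- the smallest value of the other block. This needs both blocks to be nonempty, hence `suc y` and
-- `suc z`.
blockSwap-oneDescent : ∀ a y z → OneDescent (blockSwap a (suc y) (suc z)) (a + z)
blockSwap-oneDescent a y z = oneDescent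
  (subst₂ _<_ (sym (swap⇒≡ bottom)) (sym (swap⇒≡ top))
    (≤-by (z≤n {y + z}) (solve (a ∷ y ∷ z ∷ []))))
  (blockSwap-rises a y z)
  where
  top : Swap a (suc y) (suc z) (a + z) (a + suc y + z)
  top = up ≤-refl
  bottom : Swap a (suc y) (suc z) (suc (a + z)) (a + 0)
  bottom = subst (λ i → Swap a (suc y) (suc z) i (a + 0)) i≡ (down z<s)
    where
    i≡ : a + suc z + 0 ≡ suc (a + z)
    i≡ = solve (a ∷ z ∷ [])

least : ∀ {P : ℕ → Set} → (∀ i → Dec (P i)) → ∀ m → P m →
  ∃ λ k → k ≤ m × P k × (∀ i → i < k → ¬ P i)
least P? zero p = 0 , z≤n , p , λ _ ()
least P? (suc m) p with P? 0
... | yes p₀ = 0 , z≤n , p₀ , λ _ ()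
... | no ¬p₀ with k , k≤m , pk , below ← least (P? ∘ suc) m p =
  suc k , s≤s k≤m , pk , λ { zero _ → ¬p₀ ; (suc i) (s≤s i<k) → below i i<k }

module _ {f : ℕ → ℕ} {d : ℕ} (one : OneDescent f d) where
  open OneDescent one

  increasing-left : ∀ {i j} → i < j → j ≤ d → f i < f j
  increasing-left {i} {suc j} (s≤s i≤j) j<d with m≤n⇒m<n∨m≡n i≤j
  ... | inj₁ i<j = <-trans (increasing-left i<j (<⇒≤ j<d)) (rises j (<⇒≢ j<d))
  ... | inj₂ refl = rises j (<⇒≢ j<d)

  increasing-right : ∀ {i j} → d < i → i < j → f i < f j
  increasing-right {i} {suc j} d<i (s≤s i≤j) with m≤n⇒m<n∨m≡n i≤j
  ... | inj₁ i<j = <-trans (increasing-right d<i i<j) (rises j (>⇒≢ (<-trans d<i i<j)))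
  ... | inj₂ refl = rises j (>⇒≢ d<i)

  left-≤ : ∀ {i} → i ≤ d → i ≤ f i
  left-≤ {zero} _ = z≤n
  left-≤ {suc i} i<d = ≤-<-trans (left-≤ (<⇒≤ i<d)) (rises i (<⇒≢ i<d))

  right-+ : ∀ {i} → d < i → ∀ k → k + f i ≤ f (k + i)
  right-+ d<i zero = ≤-refl
  right-+ {i} d<i (suc k) = ≤-<-trans (right-+ d<i k)
    (rises (k + i) (>⇒≢ (<-≤-trans d<i (m≤n+m i k))))

  -- Beyond `d` a shift of the position by `n` raises the value by at least `n`, and it lands in the
  -- fixed tail, where the value is `n + i`.
  right-≥ : ∀ {n} → (∀ k → n ≤ k → f k ≡ k) → ∀ {i} → d < i → f i ≤ i
  right-≥ {n} fixes {i} d<i = +-cancelˡ-≤ n _ _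
    (≤-trans (right-+ d<i n) (≤-reflexive (fixes (n + i) (m≤m+n n i))))

module _ {f g : ℕ → ℕ} {d e : ℕ} (g∘f : ∀ i → g (f i) ≡ i) (f∘g : ∀ i → f (g i) ≡ i)
         (one-f : OneDescent f d) (one-g : OneDescent g e) where

  -- Otherwise `f (suc d) < f d` would both lie where `g` increases, and applying `g` would give
  -- `suc d < d`.
  top-high : e < f d
  top-high = ≰⇒> λ fd≤e → <-asym (n<1+n d)
    (subst₂ _<_ (g∘f (suc d)) (g∘f d) (increasing-left one-g (OneDescent.falls one-f) fd≤e))

  -- Since f i ≥ i up to d and g v ≥ v up to e, every i ≤ d with f i ≤ e is fixed.
  left-blocks : ∃ λ a → a ≤ d × (∀ i → i < a → f i ≡ i) ×
    (∀ j → a + j ≤ d → f (a + j) ≡ suc e + j)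
  left-blocks with a , a≤d , e<fa , below ← least (λ i → e <? f i) d top-high =
    a , a≤d , fixed , moved
    where
    fixed : ∀ i → i < a → f i ≡ i
    fixed i i<a = ≤-antisym
      (≤-trans (left-≤ one-g (≮⇒≥ (below i i<a))) (≤-reflexive (g∘f i)))
      (left-≤ one-f (≤-trans (<⇒≤ i<a) a≤d))
    moved : ∀ j → a + j ≤ d → f (a + j) ≡ suc e + j
    moved zero _ rewrite +-identityʳ a | +-identityʳ e with m≤n⇒m<n∨m≡n e<fa
    ... | inj₂ eq = sym eq
    -- If the value `suc e` were skipped, its position would lie to the left of `a`, because `g`
    -- increases beyond `e`; minimality of `a` excludes that.
    ... | inj₁ e+1<fa = contradiction (≤-reflexive (sym (f∘g (suc e)))) (below (g (suc e))
      (subst (g (suc e) <_) (g∘f a) (increasing-right one-g ≤-refl e+1<fa)))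
    moved (suc j) a+j+1≤d rewrite +-suc a j | +-suc e j
      with m≤n⇒m<n∨m≡n (subst (_< f (suc (a + j))) (moved j (<⇒≤ a+j+1≤d))
        (OneDescent.rises one-f (a + j) (<⇒≢ a+j+1≤d)))
    ... | inj₂ eq = sym eq
    -- A skipped value `suc (suc (e + j))` would have its position strictly between `a + j` and
    -- `suc (a + j)`.
    ... | inj₁ u<f = contradiction
      (≤-<-trans
        (subst (_< g (suc (suc (e + j))))
          (trans (cong g (sym (moved j (<⇒≤ a+j+1≤d)))) (g∘f (a + j)))
          (increasing-right one-g (s≤s (m≤m+n e j)) ≤-refl))
        (subst (g (suc (suc (e + j))) <_) (g∘f (suc (a + j)))
          (increasing-right one-g (s≤s (m≤n⇒m≤1+n (m≤m+n e j))) u<f)))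
      (<-irrefl refl)

-- Applied to `f`, `left-blocks` finds the block moving up; applied to the inverse, it finds the
-- block moving down. Once both are known to start at the same `a`, the two descents `a + z` and
-- `a + y` give the sizes.
oneDescent⇒blockSwap : ∀ {f g : ℕ → ℕ} {d e n} →
  (∀ i → g (f i) ≡ i) → (∀ i → f (g i) ≡ i) → (∀ k → n ≤ k → f k ≡ k) →
  OneDescent f d → OneDescent g e →
  ∃ λ a → ∃ λ y → ∃ λ z → a + suc y + suc z ≤ n × f ≗ blockSwap a (suc y) (suc z)
oneDescent⇒blockSwap {f} {g} {d} {e} {n} g∘f f∘g f-fixes one-f one-g
  with a , a≤d , f-fixed , f-moved ← left-blocks g∘f f∘g one-f one-g
     | b , b≤e , g-fixed , g-moved ← left-blocks f∘g g∘f one-g one-f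
  with <-cmp a b
-- Here `g` fixes `a`, so `f a` would be `a`, while `left-blocks` gives it the value `suc e`, which
-- is larger.
... | tri< a<b _ _ = contradiction
  (trans (sym (f-moved 0 (subst (_≤ d) (sym (+-identityʳ a)) a≤d)))
    (trans (cong f (trans (+-identityʳ a) (sym (g-fixed a a<b)))) (f∘g a)))
  (>⇒≢ (s≤s (≤-trans (≤-trans (<⇒≤ a<b) b≤e) (m≤m+n e 0))))
... | tri> _ _ b<a = contradiction
  (trans (sym (g-moved 0 (subst (_≤ e) (sym (+-identityʳ b)) b≤e)))
    (trans (cong g (trans (+-identityʳ b) (sym (f-fixed b b<a)))) (g∘f b)))
  (>⇒≢ (s≤s (≤-trans (≤-trans (<⇒≤ b<a) a≤d) (m≤m+n d 0))))
... | tri≈ _ refl _ with z , refl ← ≤⇒+ a≤d | y , refl ← ≤⇒+ b≤e =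
  a , y , z , ≮⇒≥ n≮c , λ i → sym (swap⇒≡ (swap i))
  where
  g-fixes : ∀ k → n ≤ k → g k ≡ k
  g-fixes k n≤k = trans (cong g (sym (f-fixes k n≤k))) (g∘f k)
  f-down : ∀ j → j ≤ y → f (a + suc z + j) ≡ a + j
  f-down j j≤y = trans
    (cong f (trans (cong (_+ j) (+-suc a z)) (sym (g-moved j (+-monoʳ-≤ a j≤y)))))
    (f∘g (a + j))
  -- The last position of the downward block would already be in the fixed tail, yet it moves down
  -- by `suc z`.
  n≮c : ¬ n < a + suc y + suc z
  n≮c n<c = ⊥-by z (≤-reflexive (trans (sym (f-fixes (a + suc z + y)
      (≤-by n<c (solve (n ∷ a ∷ y ∷ z ∷ []))))) (f-down y ≤-refl))) (solve (a ∷ y ∷ z ∷ []))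
  swap : ∀ i → Swap a (suc y) (suc z) i (f i)
  swap i with i <? a | i ≤? a + z | f i ≤? a + y
  ... | yes i<a | _ | _ = swap-to (left i<a) (sym (f-fixed i i<a))
  ... | no i≮a | yes i≤d | _ with j , refl ← ≤⇒+ (≮⇒≥ i≮a) =
    swap-to (up (s≤s (+-cancelˡ-≤ a j z i≤d)))
      (sym (trans (f-moved j i≤d) (cong (_+ j) (sym (+-suc a y)))))
  ... | no _ | no i≰d | yes fi≤e = from-value (f i) refl fi≤e
    where
    from-value : ∀ v → f i ≡ v → v ≤ a + y → Swap a (suc y) (suc z) i (f i)
    from-value v fi≡v v≤e with v <? a
    ... | yes v<a = contradiction (≤-trans (≤-reflexive i≡v) (≤-trans (<⇒≤ v<a) a≤d)) i≰d
      where
      i≡v : i ≡ v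
      i≡v = trans (sym (g∘f i)) (trans (cong g (trans fi≡v (sym (f-fixed v v<a)))) (g∘f v))
    ... | no v≮a with j , refl ← ≤⇒+ (≮⇒≥ v≮a) =
      subst₂ (Swap a (suc y) (suc z))
        (trans (cong (_+ j) (+-suc a z)) (trans (sym (g-moved j v≤e))
          (trans (cong g (sym fi≡v)) (g∘f i))))
        (sym fi≡v) (down (s≤s (+-cancelˡ-≤ a j y v≤e)))
  ... | no _ | no i≰d | no fi≰e = swap-to (right (≮⇒≥ i≮c)) (sym fi≡i)
    where
    -- Position and value are both beyond the respective descents, so `right-≥` bounds `f i` by `i`
    -- and, through the inverse, `i` by `f i`.
    fi≡i : f i ≡ i
    fi≡i = ≤-antisym (right-≥ one-f f-fixes (≰⇒> i≰d))
      (subst (_≤ f i) (g∘f i) (right-≥ one-g g-fixes (≰⇒> fi≰e)))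
    i≮c : ¬ i < a + suc y + suc z
    i≮c i<c with j , refl ← ≤⇒+ (≰⇒> i≰d) = fi≰e (subst (_≤ a + y) (sym fi≡) (+-monoʳ-≤ a j≤y))
      where
      j≤y : j ≤ y
      j≤y = ≤-by i<c (solve (a ∷ y ∷ z ∷ j ∷ []))
      fi≡ : f (suc (a + z) + j) ≡ a + j
      fi≡ = trans (cong (λ k → f (k + j)) (sym (+-suc a z))) (f-down j j≤y)

-- Permutations of Fin n as permutations of ℕ

-- Fixing the numbers from n on makes bounds on positions unnecessary.
ext : Permutation′ n → ℕ → ℕ
ext {n} σ k with k <? n
... | yes k<n = toℕ (σ ⟨$⟩ʳ fromℕ< k<n)
... | no _ = k

ext-toℕ : ∀ (σ : Permutation′ n) i → ext σ (toℕ i) ≡ toℕ (σ ⟨$⟩ʳ i)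
ext-toℕ {n} σ i with toℕ i <? n
... | yes i<n = cong (λ k → toℕ (σ ⟨$⟩ʳ k)) (fromℕ<-toℕ i i<n)
... | no i≮n = contradiction (toℕ<n i) i≮n

ext-fixes : ∀ (σ : Permutation′ n) k → n ≤ k → ext σ k ≡ k
ext-fixes {n} σ k n≤k with k <? n
... | yes k<n = contradiction k<n (≤⇒≯ n≤k)
... | no _ = refl

-- Matching on this view replaces `k` by `toℕ i`, the form to which `ext-toℕ` applies.
data Position (n : ℕ) : ℕ → Set where
  inside : (i : Fin n) → Position n (toℕ i)
  outside : ∀ {k} → n ≤ k → Position n k

position : ∀ n k → Position n k
position n k with k <? n
... | yes k<n = subst (Position n) (toℕ-fromℕ< k<n) (inside (fromℕ< k<n))
... | no k≮n = outside (≮⇒≥ k≮n)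

ext-flip : ∀ (σ : Permutation′ n) k → ext (flip σ) (ext σ k) ≡ k
ext-flip {n} σ k with position n k
... | inside i = trans (cong (ext (flip σ)) (ext-toℕ σ i))
  (trans (ext-toℕ (flip σ) (σ ⟨$⟩ʳ i)) (cong toℕ (inverseˡ σ)))
... | outside n≤k = trans (cong (ext (flip σ)) (ext-fixes σ k n≤k)) (ext-fixes (flip σ) k n≤k)

ext-flip′ : ∀ (σ : Permutation′ n) k → ext σ (ext (flip σ) k) ≡ k
ext-flip′ {n} σ k with position n k
... | inside i = trans (cong (ext σ) (ext-toℕ (flip σ) i))
  (trans (ext-toℕ σ (σ ⟨$⟩ˡ i)) (cong toℕ (inverseʳ σ)))
... | outside n≤k = trans (cong (ext σ) (ext-fixes (flip σ) k n≤k)) (ext-fixes σ k n≤k)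

ext-cong : ∀ (σ τ : Permutation′ n) → σ ≈ τ → ext σ ≗ ext τ
ext-cong {n} σ τ σ≈τ k with position n k
... | inside i = trans (ext-toℕ σ i) (trans (cong toℕ (σ≈τ i)) (sym (ext-toℕ τ i)))
... | outside n≤k = trans (ext-fixes σ k n≤k) (sym (ext-fixes τ k n≤k))

ext-injective : ∀ (σ τ : Permutation′ n) → ext σ ≗ ext τ → σ ≈ τ
ext-injective σ τ eq i =
  toℕ-injective (trans (sym (ext-toℕ σ i)) (trans (eq (toℕ i)) (ext-toℕ τ i)))

ext-flip-unique : ∀ (σ : Permutation′ n) {f g : ℕ → ℕ} → (∀ k → f (g k) ≡ k) →
  ext σ ≗ f → ext (flip σ) ≗ g
ext-flip-unique σ {f} {g} f∘g σ≗f k =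
  trans (cong (ext (flip σ)) (trans (sym (f∘g k)) (sym (σ≗f (g k))))) (ext-flip σ (g k))

module _ (f g : ℕ → ℕ) (f< : ∀ {k} → k < n → f k < n) (g< : ∀ {k} → k < n → g k < n)
         (f∘g : ∀ k → f (g k) ≡ k) (g∘f : ∀ k → g (f k) ≡ k)
         where

  restrict : Permutation′ n
  restrict = permutation (λ i → fromℕ< (f< (toℕ<n i))) (λ i → fromℕ< (g< (toℕ<n i)))
    (λ i → toℕ-injective (trans (toℕ-fromℕ< _) (trans (cong f (toℕ-fromℕ< _)) (f∘g (toℕ i)))))
    (λ i → toℕ-injective (trans (toℕ-fromℕ< _) (trans (cong g (toℕ-fromℕ< _)) (g∘f (toℕ i)))))

  ext-restrict : (∀ k → n ≤ k → f k ≡ k) → ext restrict ≗ f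
  ext-restrict f-fixes k with position n k
  ... | inside i = trans (ext-toℕ restrict i) (toℕ-fromℕ< _)
  ... | outside n≤k = trans (ext-fixes restrict k n≤k) (sym (f-fixes k n≤k))

-- A position from `n` on keeps its value, which exceeds every value inside and every earlier fixed
-- one, so it cannot end an inversion.
inversion-< : ∀ (σ : Permutation′ n) {i j} → i < j → ext σ j < ext σ i → j < n
inversion-< {n} σ {i} {j} i<j σj<σi with position n j
... | inside k = toℕ<n k
... | outside n≤j with position n i
... | inside k = contradiction (subst₂ _<_ (ext-fixes σ j n≤j) (ext-toℕ σ k) σj<σi)
  (≤⇒≯ (≤-trans (<⇒≤ (toℕ<n _)) n≤j))
... | outside n≤i =
  contradiction i<j (<⇒≯ (subst₂ _<_ (ext-fixes σ j n≤j) (ext-fixes σ i n≤i) σj<σi))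

-- Descents of a permutation and its block form

descent⇒< : ∀ (σ : Permutation′ n) i → Descent σ i → ext σ (suc (toℕ i)) < ext σ (toℕ i)
descent⇒< σ i (j , j≡i+1 , σj<σi) =
  subst₂ _<_ (trans (sym (ext-toℕ σ j)) (cong (ext σ) j≡i+1)) (sym (ext-toℕ σ i)) σj<σi

<⇒descent : ∀ (σ : Permutation′ n) {k} → ext σ (suc k) < ext σ k →
  ∃ λ i → toℕ i ≡ k × Descent σ i
<⇒descent σ {k} falls = i , i≡k , j , trans j≡k+1 (cong suc (sym i≡k)) ,
  subst₂ _<_ (trans (cong (ext σ) (sym j≡k+1)) (ext-toℕ σ j))
             (trans (cong (ext σ) (sym i≡k)) (ext-toℕ σ i)) falls
  where
  k+1<n = inversion-< σ (n<1+n k) falls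
  j = fromℕ< k+1<n
  j≡k+1 = toℕ-fromℕ< k+1<n
  i = fromℕ< (<⇒≤ k+1<n)
  i≡k = toℕ-fromℕ< (<⇒≤ k+1<n)

oneDescent⇒∃! : ∀ (σ : Permutation′ n) {d} → OneDescent (ext σ) d → ∃! _≡_ (Descent σ)
oneDescent⇒∃! σ {d} (oneDescent falls rises) with i , refl , descent ← <⇒descent σ falls =
  i , descent , unique
  where
  unique : ∀ {k} → Descent σ k → i ≡ k
  unique {k} descent′ with toℕ k ≟ toℕ i
  ... | yes k≡i = toℕ-injective (sym k≡i)
  ... | no k≢i = contradiction (descent⇒< σ k descent′) (<⇒≯ (rises (toℕ k) k≢i))

∃!⇒oneDescent : ∀ (σ : Permutation′ n) → ∃! _≡_ (Descent σ) → ∃ (OneDescent (ext σ))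
∃!⇒oneDescent σ (i , descent , unique) =
  -- Away from `i`, not falling means rising strictly, because injectivity excludes equal
  -- neighbours.
  toℕ i , oneDescent (descent⇒< σ i descent) (λ k k≢i → ≤∧≢⇒< (≮⇒≥ (no-fall k k≢i)) (distinct k))
  where
  no-fall : ∀ k → k ≢ toℕ i → ¬ ext σ (suc k) < ext σ k
  no-fall k k≢i falls with j , j≡k , descent′ ← <⇒descent σ falls =
    k≢i (trans (sym j≡k) (cong toℕ (sym (unique descent′))))
  distinct : ∀ k → ext σ k ≢ ext σ (suc k)
  distinct k eq = <⇒≢ (n<1+n k)
    (trans (sym (ext-flip σ k)) (trans (cong (ext (flip σ)) eq) (ext-flip σ (suc k))))

bigrassmannian⇒blockSwap : ∀ (σ : Permutation′ n) → Bigrassmannian σ →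
  ∃ λ a → ∃ λ y → ∃ λ z → a + suc y + suc z ≤ n × ext σ ≗ blockSwap a (suc y) (suc z)
bigrassmannian⇒blockSwap σ (one , one⁻¹) = oneDescent⇒blockSwap (ext-flip σ) (ext-flip′ σ)
  (ext-fixes σ) (proj₂ (∃!⇒oneDescent σ one)) (proj₂ (∃!⇒oneDescent (flip σ) one⁻¹))

blockSwap-bigrassmannian : ∀ (σ : Permutation′ n) a y z →
  ext σ ≗ blockSwap a (suc y) (suc z) → Bigrassmannian σ
blockSwap-bigrassmannian σ a y z eq =
  oneDescent⇒∃! σ (OneDescent-cong eq (blockSwap-oneDescent a y z)) ,
  oneDescent⇒∃! (flip σ) (OneDescent-cong
    (ext-flip-unique σ (blockSwap-inverse a (suc y) (suc z)) eq) (blockSwap-oneDescent a z y))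

blockPermutation : ∀ a p q → a + p + q ≤ n → ∃ λ (σ : Permutation′ n) → ext σ ≗ blockSwap a p q
blockPermutation {n} a p q c≤n =
  restrict (blockSwap a p q) (blockSwap a q p) (bound p q c≤n) (bound q p c′≤n)
    (blockSwap-inverse a p q) (blockSwap-inverse a q p) ,
  ext-restrict (blockSwap a p q) (blockSwap a q p) (bound p q c≤n) (bound q p c′≤n)
    (blockSwap-inverse a p q) (blockSwap-inverse a q p)
    (λ k n≤k → swap⇒≡ {a} {p} {q} (right (≤-trans c≤n n≤k)))
  where
  c′≤n : a + q + p ≤ n
  c′≤n = subst (_≤ n) (+-swapʳ a p q) c≤n
  bound : ∀ p q → a + p + q ≤ n → ∀ {k} → k < n → blockSwap a p q k < n
  bound p q c≤n k<n = swap-< c≤n k<n (swap-blockSwap a p q _)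

-- Reductions

record Exchange (f f′ : ℕ → ℕ) (i j : ℕ) : Set where
  constructor exchange
  field
    at-i : f′ i ≡ f j
    at-j : f′ j ≡ f i
    elsewhere : ∀ k → k ≢ i → k ≢ j → f′ k ≡ f k

open Exchange

Reduces : (f f′ : ℕ → ℕ) → Set
Reduces f f′ = ∃₂ λ i j → i < j × f j < f i × Exchange f f′ i j

transpose-at-i : ∀ (i j : Fin n) → PC.transpose i j i ≡ j
transpose-at-i i j with i Fin.≟ i
... | yes _ = refl
... | no i≢i = contradiction refl i≢i

transpose-at-j : ∀ (i j : Fin n) → PC.transpose i j j ≡ i
transpose-at-j i j with j Fin.≟ i
... | yes j≡i = j≡i
... | no _ with j Fin.≟ j
... | yes _ = refl
... | no j≢j = contradiction refl j≢j

transpose-elsewhere : ∀ (i j k : Fin n) → k ≢ i → k ≢ j → PC.transpose i j k ≡ k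
transpose-elsewhere i j k k≢i k≢j with k Fin.≟ i
... | yes k≡i = contradiction k≡i k≢i
... | no _ with k Fin.≟ j
... | yes k≡j = contradiction k≡j k≢j
... | no _ = refl

transpose-exchange : ∀ (σ : Permutation′ n) i j →
  Exchange (ext σ) (ext (transpose i j ∘ₚ σ)) (toℕ i) (toℕ j)
transpose-exchange {n} σ i j = exchange
  (to (transpose-at-i i j)) (to (transpose-at-j i j)) rest
  where
  to : ∀ {k l} → PC.transpose i j k ≡ l → ext (transpose i j ∘ₚ σ) (toℕ k) ≡ ext σ (toℕ l)
  to {k} {l} eq = trans (ext-toℕ (transpose i j ∘ₚ σ) k)
    (trans (cong (λ m → toℕ (σ ⟨$⟩ʳ m)) eq) (sym (ext-toℕ σ l)))
  rest : ∀ k → k ≢ toℕ i → k ≢ toℕ j → ext (transpose i j ∘ₚ σ) k ≡ ext σ k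
  rest k k≢i k≢j with position n k
  ... | inside k = to (transpose-elsewhere i j k (k≢i ∘ cong toℕ) (k≢j ∘ cong toℕ))
  ... | outside n≤k = trans (ext-fixes (transpose i j ∘ₚ σ) k n≤k) (sym (ext-fixes σ k n≤k))

exchange-unique : ∀ {f f′ f″ i j} → Exchange f f′ i j → Exchange f f″ i j → f′ ≗ f″
exchange-unique {i = i} {j} ex ex′ k with k ≟ i
... | yes refl = trans (at-i ex) (sym (at-i ex′))
... | no k≢i with k ≟ j
... | yes refl = trans (at-j ex) (sym (at-j ex′))
... | no k≢j = trans (elsewhere ex k k≢i k≢j) (sym (elsewhere ex′ k k≢i k≢j))

exchange-cong : ∀ {f f₁ f′ f₁′ i j} → f ≗ f₁ → f′ ≗ f₁′ → Exchange f f′ i j → Exchange f₁ f₁′ i j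
exchange-cong {i = i} {j} eq eq′ (exchange at-i at-j elsewhere) = exchange
  (trans (sym (eq′ i)) (trans at-i (eq j))) (trans (sym (eq′ j)) (trans at-j (eq i)))
  (λ k k≢i k≢j → trans (sym (eq′ k)) (trans (elsewhere k k≢i k≢j) (eq k)))

reduction⇒reduces : ∀ (σ τ : Permutation′ n) → Reduction σ τ → Reduces (ext σ) (ext τ)
reduction⇒reduces σ τ (i , j , i<j , σi>σj , τ≈) =
  toℕ i , toℕ j , i<j , subst₂ _<_ (sym (ext-toℕ σ j)) (sym (ext-toℕ σ i)) σi>σj ,
  exchange-cong (λ _ → refl) (sym ∘ ext-cong τ _ τ≈) (transpose-exchange σ i j)

reduces⇒reduction : ∀ (σ τ : Permutation′ n) → Reduces (ext σ) (ext τ) → Reduction σ τ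
reduces⇒reduction {n} σ τ (i , j , i<j , σj<σi , ex)
  with position n i | position n j
... | _ | outside n≤j = contradiction (inversion-< σ i<j σj<σi) (≤⇒≯ n≤j)
... | outside n≤i | inside j = contradiction (<-trans i<j (toℕ<n j)) (≤⇒≯ n≤i)
... | inside i | inside j =
  i , j , i<j , subst₂ _<_ (ext-toℕ σ j) (ext-toℕ σ i) σj<σi ,
  ext-injective τ _ (exchange-unique ex (transpose-exchange σ i j))

reduce : ∀ (σ : Permutation′ n) {i j} → i < j → ext σ j < ext σ i →
  ∃ λ τ → Reduction σ τ × Exchange (ext σ) (ext τ) i j
reduce {n} σ {i} {j} i<j σj<σi with position n i | position n j
... | _ | outside n≤j = contradiction (inversion-< σ i<j σj<σi) (≤⇒≯ n≤j)
... | outside n≤i | inside j = contradiction (<-trans i<j (toℕ<n j)) (≤⇒≯ n≤i)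
... | inside i | inside j = transpose i j ∘ₚ σ ,
  (i , j , i<j , subst₂ _<_ (ext-toℕ σ j) (ext-toℕ σ i) σj<σi , λ _ → refl) ,
  transpose-exchange σ i j

-- Exchanging the entries in positions `i` and `j` exchanges the positions of the values `f i` and
-- `f j`. The inversion `i < j`, `f j < f i` is one of the inverse as well, with positions and
-- values in opposite roles.
reduces-inverse : ∀ {f f′ g g′ : ℕ → ℕ} → (∀ k → g (f k) ≡ k) → (∀ k → g′ (f′ k) ≡ k) →
  (∀ k → f′ (g′ k) ≡ k) → Reduces f f′ → Reduces g g′
reduces-inverse {f} {f′} {g} {g′} g∘f g′∘f′ f′∘g′
  (i , j , i<j , fj<fi , exchange at-i at-j elsewhere) =
  f j , f i , fj<fi , subst₂ _<_ (sym (g∘f i)) (sym (g∘f j)) i<j ,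
  exchange
    (trans (cong g′ (sym at-i)) (trans (g′∘f′ i) (sym (g∘f i))))
    (trans (cong g′ (sym at-j)) (trans (g′∘f′ j) (sym (g∘f j))))
    (λ k k≢fj k≢fi → trans (sym (g∘f (g′ k))) (cong g (trans (sym (elsewhere (g′ k)
      (λ eq → k≢fj (trans (sym (f′∘g′ k)) (trans (cong f′ eq) at-i)))
      (λ eq → k≢fi (trans (sym (f′∘g′ k)) (trans (cong f′ eq) at-j))))) (f′∘g′ k))))

reduction-flip : ∀ (σ τ : Permutation′ n) → Reduction σ τ → Reduction (flip σ) (flip τ)
reduction-flip σ τ r = reduces⇒reduction (flip σ) (flip τ)
  (reduces-inverse (ext-flip σ) (ext-flip τ) (ext-flip′ τ) (reduction⇒reduces σ τ r))

flip-cong : ∀ (σ τ : Permutation′ n) → σ ≈ τ → flip σ ≈ flip τ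
flip-cong σ τ σ≈τ = ext-injective (flip σ) (flip τ)
  (ext-flip-unique σ (ext-flip′ τ) (ext-cong σ τ σ≈τ))

≤ᴮ-flip : ∀ (π σ : Permutation′ n) → π ≤ᴮ σ → flip π ≤ᴮ flip σ
≤ᴮ-flip π σ (τ , σ→τ , τ≈π) =
  flip τ , gmap flip (λ {ρ} {υ} → reduction-flip ρ υ) σ→τ , flip-cong τ π τ≈π

reduction-cong : ∀ (σ σ′ τ : Permutation′ n) → σ ≈ σ′ → Reduction σ τ → Reduction σ′ τ
reduction-cong σ σ′ τ σ≈σ′ (i , j , i<j , σi>σj , τ≈) =
  i , j , i<j , subst₂ Fin._>_ (σ≈σ′ i) (σ≈σ′ j) σi>σj ,
  λ k → trans (τ≈ k) (σ≈σ′ _)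

≤ᴮ-reflexive : ∀ (π σ : Permutation′ n) → π ≈ σ → π ≤ᴮ σ
≤ᴮ-reflexive π σ π≈σ = σ , ε , sym ∘ π≈σ

≤ᴮ-trans : ∀ (π ρ σ : Permutation′ n) → π ≤ᴮ ρ → ρ ≤ᴮ σ → π ≤ᴮ σ
≤ᴮ-trans π ρ σ (.ρ , ε , ρ≈π) (υ , σ→υ , υ≈ρ) = υ , σ→υ , λ i → trans (υ≈ρ i) (ρ≈π i)
≤ᴮ-trans π ρ σ (τ , _◅_ {j = κ} r κ→τ , τ≈π) (υ , σ→υ , υ≈ρ) =
  τ , σ→υ ◅◅ reduction-cong ρ υ κ (sym ∘ υ≈ρ) r ◅ κ→τ , τ≈π

≤ᴮ-step : ∀ (π ρ σ : Permutation′ n) → π ≤ᴮ ρ → Reduction σ ρ → π ≤ᴮ σ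
≤ᴮ-step π ρ σ (τ , ρ→τ , τ≈π) r = τ , r ◅ ρ→τ , τ≈π

-- The entry at `s + k` passes its larger left neighbours one by one, by `k` adjacent reductions.
-- The target is described by its values, so the induction ends in a pointwise equality.
slide-left : ∀ k s (σ τ : Permutation′ n) →
  (∀ m → m < k → ext σ (s + k) < ext σ (s + m)) →
  ext τ s ≡ ext σ (s + k) →
  (∀ m → m < k → ext τ (s + suc m) ≡ ext σ (s + m)) →
  (∀ i → i < s ⊎ s + k < i → ext τ i ≡ ext σ i) →
  τ ≤ᴮ σ
slide-left zero s σ τ _ at-s _ rest = ≤ᴮ-reflexive τ σ (ext-injective τ σ same)
  where
  same : ext τ ≗ ext σ
  same i with <-cmp i s
  ... | tri< i<s _ _ = rest i (inj₁ i<s)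
  ... | tri≈ _ refl _ = trans at-s (cong (ext σ) (+-identityʳ s))
  ... | tri> _ _ s<i = rest i (inj₂ (subst (_< i) (sym (+-identityʳ s)) s<i))
slide-left (suc k) s σ τ small at-s moved rest
  with ρ , r , ex ← reduce σ (+-monoʳ-< s (n<1+n k)) (small k ≤-refl) =
  ≤ᴮ-step τ ρ σ (slide-left k s ρ τ
    (λ m m<k → subst₂ _<_ (sym (at-i ex)) (sym (unmoved m m<k)) (small m (m<n⇒m<1+n m<k)))
    (trans at-s (sym (at-i ex)))
    (λ m m<k → trans (moved m (m<n⇒m<1+n m<k)) (sym (unmoved m m<k)))
    rest′) r
  where
  unmoved : ∀ m → m < k → ext ρ (s + m) ≡ ext σ (s + m)
  unmoved m m<k = elsewhere ex (s + m) (<⇒≢ (+-monoʳ-< s m<k)) (<⇒≢ (+-monoʳ-< s (m<n⇒m<1+n m<k)))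
  rest′ : ∀ i → i < s ⊎ s + k < i → ext τ i ≡ ext ρ i
  rest′ i (inj₁ i<s) = trans (rest i (inj₁ i<s)) (sym (elsewhere ex i
    (<⇒≢ (<-≤-trans i<s (m≤m+n s k))) (<⇒≢ (<-≤-trans i<s (m≤m+n s (suc k))))))
  rest′ i (inj₂ s+k<i) with m≤n⇒m<n∨m≡n s+k<i
  ... | inj₂ refl = trans (cong (ext τ) (sym (+-suc s k)))
    (trans (moved k ≤-refl) (sym (trans (cong (ext ρ) (sym (+-suc s k))) (at-j ex))))
  ... | inj₁ s+k+1<i = trans (rest i (inj₂ (subst (_< i) (sym (+-suc s k)) s+k+1<i)))
    (sym (elsewhere ex i (>⇒≢ s+k<i) (>⇒≢ (subst (_< i) (sym (+-suc s k)) s+k+1<i))))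

-- The mirror image: the entry at `s` passes smaller right neighbours, and `s` advances with it in
-- the induction.
slide-right : ∀ k s (σ τ : Permutation′ n) →
  (∀ m → m < k → ext σ (suc (s + m)) < ext σ s) →
  ext τ (s + k) ≡ ext σ s →
  (∀ m → m < k → ext τ (s + m) ≡ ext σ (suc (s + m))) →
  (∀ i → i < s ⊎ s + k < i → ext τ i ≡ ext σ i) →
  τ ≤ᴮ σ
slide-right zero s σ τ _ at-s _ rest = ≤ᴮ-reflexive τ σ (ext-injective τ σ same)
  where
  same : ext τ ≗ ext σ
  same i with <-cmp i s
  ... | tri< i<s _ _ = rest i (inj₁ i<s)
  ... | tri≈ _ refl _ = trans (cong (ext τ) (sym (+-identityʳ s))) at-s
  ... | tri> _ _ s<i = rest i (inj₂ (subst (_< i) (sym (+-identityʳ s)) s<i))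
slide-right (suc k) s σ τ small at-end moved rest
  with ρ , r , ex ← reduce σ (n<1+n s)
    (subst (λ i → ext σ (suc i) < ext σ s) (+-identityʳ s) (small 0 z<s)) =
  ≤ᴮ-step τ ρ σ (slide-right k (suc s) ρ τ
    (λ m m<k → subst₂ _<_ (sym (unmoved m)) (sym (at-j ex))
      (subst (λ i → ext σ (suc i) < ext σ s) (+-suc s m) (small (suc m) (s<s m<k))))
    (trans (trans (cong (ext τ) (sym (+-suc s k))) at-end) (sym (at-j ex)))
    (λ m m<k → trans (subst (λ i → ext τ i ≡ ext σ (suc i)) (+-suc s m) (moved (suc m) (s<s m<k)))
      (sym (unmoved m)))
    rest′) r
  where
  unmoved : ∀ m → ext ρ (suc (suc s + m)) ≡ ext σ (suc (suc s + m))
  unmoved m = elsewhere ex _ (>⇒≢ (m<n⇒m<1+n (s≤s (m≤m+n s m)))) (>⇒≢ (s≤s (s≤s (m≤m+n s m))))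
  rest′ : ∀ i → i < suc s ⊎ suc s + k < i → ext τ i ≡ ext ρ i
  rest′ i (inj₁ (s≤s i≤s)) with m≤n⇒m<n∨m≡n i≤s
  ... | inj₁ i<s = trans (rest i (inj₁ i<s)) (sym (elsewhere ex i (<⇒≢ i<s) (<⇒≢ (m<n⇒m<1+n i<s))))
  ... | inj₂ refl = trans (subst (λ j → ext τ j ≡ ext σ (suc j)) (+-identityʳ s) (moved 0 z<s))
    (sym (at-i ex))
  rest′ i (inj₂ s+k<i) = trans (rest i (inj₂ (subst (_< i) (sym (+-suc s k)) s+k<i)))
    (sym (elsewhere ex i (>⇒≢ (≤-<-trans (m≤m+n s k) (<-trans (n<1+n (s + k)) s+k<i)))
      (>⇒≢ (≤-<-trans (s≤s (m≤m+n s k)) s+k<i))))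

-- Bruhat order on block exchanges

ext-value : ∀ (σ : Permutation′ n) {a p q i v} → ext σ ≗ blockSwap a p q → Swap a p q i v →
  ext σ i ≡ v
ext-value σ eq s = trans (eq _) (swap⇒≡ s)

-- The value `a`, first in the downward block, slides left past the whole upward block and becomes a
-- fixed point at position `a`.
shrink-p-raise-a : ∀ (σ τ : Permutation′ n) a p q → ext σ ≗ blockSwap a (suc p) q →
  ext τ ≗ blockSwap (suc a) p q → τ ≤ᴮ σ
shrink-p-raise-a σ τ a p q σ≗ τ≗ = slide-left q a σ τ small
  (trans (on-τ (left (n<1+n a))) (sym σ-small))
  (λ m m<q → trans (cong (ext τ) (+-suc a m))
    (trans (on-τ (up m<q)) (trans (cong (_+ m) (sym (+-suc a p))) (sym (on-σ (up m<q))))))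
  rest
  where
  on-σ : ∀ {i v} → Swap a (suc p) q i v → ext σ i ≡ v
  on-σ = ext-value σ σ≗
  on-τ : ∀ {i v} → Swap (suc a) p q i v → ext τ i ≡ v
  on-τ = ext-value τ τ≗
  σ-small : ext σ (a + q) ≡ a
  σ-small = trans (cong (ext σ) (sym (+-identityʳ (a + q))))
    (trans (on-σ (down {j = 0} z<s)) (+-identityʳ a))
  small : ∀ m → m < q → ext σ (a + q) < ext σ (a + m)
  small m m<q = subst₂ _<_ (sym σ-small) (sym (on-σ (up m<q)))
    (≤-by (z≤n {p + m}) (solve (a ∷ p ∷ m ∷ [])))
  same : ∀ {i v} → i < a ⊎ a + q < i → Swap a (suc p) q i v → ext τ i ≡ v
  same _ (left i<a) = on-τ (left (m<n⇒m<1+n i<a))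
  same (inj₁ a+j<a) (up {j} _) = contradiction a+j<a (≤⇒≯ (m≤m+n a j))
  same (inj₂ a+q<a+j) (up {j} j<q) = contradiction (+-cancelˡ-< a q j a+q<a+j) (<⇒≯ j<q)
  same (inj₁ i<a) (down {j} _) = ⊥-elim (⊥-by (q + j) i<a (solve (a ∷ q ∷ j ∷ [])))
  same (inj₂ a+q<i) (down {zero} _) = contradiction (sym (+-identityʳ (a + q))) (<⇒≢ a+q<i)
  same (inj₂ _) (down {suc j} (s≤s j<p)) = trans (cong (ext τ) (+-suc (a + q) j))
    (trans (on-τ (down j<p)) (sym (+-suc a j)))
  same {i} _ (right c≤i) = on-τ (right (≤-by c≤i (solve (i ∷ a ∷ p ∷ q ∷ []))))
  rest : ∀ i → i < a ⊎ a + q < i → ext τ i ≡ ext σ i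
  rest i side = trans (same side (swap-blockSwap a (suc p) q i)) (sym (σ≗ i))

-- The largest value `a + p + q`, last in the upward block, slides right past the whole downward
-- block and becomes a fixed point.
shrink-q : ∀ (σ τ : Permutation′ n) a p q → ext σ ≗ blockSwap a p (suc q) →
  ext τ ≗ blockSwap a p q → τ ≤ᴮ σ
shrink-q σ τ a p q σ≗ τ≗ = slide-right p (a + q) σ τ small
  (trans (on-τ (right (≤-reflexive (+-swapʳ a p q)))) (trans (+-swapʳ a q p) (sym σ-large)))
  (λ m m<p → trans (on-τ (down m<p)) (sym (σ-down m m<p)))
  rest
  where
  on-σ : ∀ {i v} → Swap a p (suc q) i v → ext σ i ≡ v
  on-σ = ext-value σ σ≗
  on-τ : ∀ {i v} → Swap a p q i v → ext τ i ≡ v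
  on-τ = ext-value τ τ≗
  σ-large : ext σ (a + q) ≡ a + p + q
  σ-large = on-σ (up ≤-refl)
  σ-down : ∀ m → m < p → ext σ (suc (a + q + m)) ≡ a + m
  σ-down m m<p = trans (cong (λ k → ext σ (k + m)) (sym (+-suc a q))) (on-σ (down m<p))
  small : ∀ m → m < p → ext σ (suc (a + q + m)) < ext σ (a + q)
  small m m<p = subst₂ _<_ (sym (σ-down m m<p)) (sym σ-large)
    (≤-by (m<p ⊕ z≤n {q}) (solve (a ∷ p ∷ q ∷ m ∷ [])))
  same-left : ∀ {i v} → i < a + q → Swap a p q i v → ext σ i ≡ v
  same-left _ (left i<a) = on-σ (left i<a)
  same-left _ (up j<q) = on-σ (up (m<n⇒m<1+n j<q))
  same-left i<a+q (down {j} _) = contradiction i<a+q (≤⇒≯ (m≤m+n (a + q) j))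
  same-left {i} i<a+q (right c≤i) = ⊥-elim (⊥-by p (i<a+q ⊕ c≤i) (solve (i ∷ a ∷ p ∷ q ∷ [])))
  rest : ∀ i → i < a + q ⊎ a + q + p < i → ext τ i ≡ ext σ i
  rest i (inj₁ i<a+q) = trans (τ≗ i) (sym (same-left i<a+q (swap-blockSwap a p q i)))
  rest i (inj₂ c<i) = trans
    (on-τ (right (≤-by (<⇒≤ c<i) (solve (i ∷ a ∷ p ∷ q ∷ [])))))
    (sym (on-σ (right (≤-by c<i (solve (i ∷ a ∷ p ∷ q ∷ []))))))

ext-flip-blockSwap : ∀ (σ : Permutation′ n) a p q → ext σ ≗ blockSwap a p q →
  ext (flip σ) ≗ blockSwap a q p
ext-flip-blockSwap σ a p q = ext-flip-unique σ (blockSwap-inverse a p q)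

shrink-q-raise-a : ∀ (σ τ : Permutation′ n) a p q → ext σ ≗ blockSwap a p (suc q) →
  ext τ ≗ blockSwap (suc a) p q → τ ≤ᴮ σ
shrink-q-raise-a σ τ a p q σ≗ τ≗ = ≤ᴮ-flip (flip τ) (flip σ)
  (shrink-p-raise-a (flip σ) (flip τ) a q p
    (ext-flip-blockSwap σ a p (suc q) σ≗) (ext-flip-blockSwap τ (suc a) p q τ≗))

shrink-p : ∀ (σ τ : Permutation′ n) a p q → ext σ ≗ blockSwap a (suc p) q →
  ext τ ≗ blockSwap a p q → τ ≤ᴮ σ
shrink-p σ τ a p q σ≗ τ≗ = ≤ᴮ-flip (flip τ) (flip σ)
  (shrink-q (flip σ) (flip τ) a q p
    (ext-flip-blockSwap σ a (suc p) q σ≗) (ext-flip-blockSwap τ a p q τ≗))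

-- Properties that survive reductions

module _ (R : ℕ → ℕ → Set) (R-mono : ∀ {i j u v} → i ≤ j → v ≤ u → R i u → R j v) where

  -- At `i` the value drops; at `j` appears a value that was previously further left. Both changes
  -- are allowed by `R-mono`.
  reduces-invariant : ∀ {f f′} → Reduces f f′ → (∀ k → R k (f k)) → ∀ k → R k (f′ k)
  reduces-invariant (i , j , i<j , fj<fi , ex) Rf k with k ≟ i
  ... | yes refl = R-mono ≤-refl (≤-trans (≤-reflexive (Exchange.at-i ex)) (<⇒≤ fj<fi)) (Rf i)
  ... | no k≢i with k ≟ j
  ... | yes refl = R-mono (<⇒≤ i<j) (≤-reflexive (Exchange.at-j ex)) (Rf i)
  ... | no k≢j = R-mono ≤-refl (≤-reflexive (Exchange.elsewhere ex k k≢i k≢j)) (Rf k)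

  ≤ᴮ-invariant : ∀ (π σ : Permutation′ n) → π ≤ᴮ σ →
    (∀ k → R k (ext σ k)) → ∀ k → R k (ext π k)
  ≤ᴮ-invariant π σ (.σ , ε , σ≈π) Rσ k = subst (R k) (ext-cong σ π σ≈π k) (Rσ k)
  ≤ᴮ-invariant π σ (τ , _◅_ {j = κ} r κ→τ , τ≈π) Rσ =
    ≤ᴮ-invariant π κ (τ , κ→τ , τ≈π) (reduces-invariant (reduction⇒reduces σ κ r) Rσ)

-- Each conjunct detects one parameter of a block exchange: its start `a`, its first size `p`, its
-- end `c`. The other size is compared through inverses.
Bounded : (a p c i v : ℕ) → Set
Bounded a p c i v = (i < a → v ≤ i) × v ≤ i + p × (c ≤ v → v ≤ i)

bounded-mono : ∀ {a p c i j u v} → i ≤ j → v ≤ u → Bounded a p c i u → Bounded a p c j v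
bounded-mono {p = p} i≤j v≤u (low , mid , high) =
  (λ j<a → ≤-trans v≤u (≤-trans (low (≤-<-trans i≤j j<a)) i≤j)) ,
  ≤-trans v≤u (≤-trans mid (+-monoˡ-≤ p i≤j)) ,
  (λ c≤v → ≤-trans v≤u (≤-trans (high (≤-trans c≤v v≤u)) i≤j))

swap-bounded : ∀ {a p q i v} → Swap a p q i v → Bounded a p (a + p + q) i v
swap-bounded {p = p} (left {i} i<a) = (λ _ → ≤-refl) , m≤m+n i p , λ _ → ≤-refl
swap-bounded {a} {p} {q} (up {j} j<q) =
  (λ a+j<a → contradiction a+j<a (≤⇒≯ (m≤m+n a j))) ,
  ≤-reflexive (+-swapʳ a p j) ,
  (λ c≤v → contradiction (+-cancelˡ-≤ (a + p) q j c≤v) (<⇒≱ j<q))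
swap-bounded {a} {p} {q} (down {j} j<p) = (λ _ → below) , ≤-trans below (m≤m+n _ p) , λ _ → below
  where
  below : a + j ≤ a + q + j
  below = +-monoˡ-≤ j (m≤m+n a q)
swap-bounded {p = p} (right {i} c≤i) = (λ _ → ≤-refl) , m≤m+n i p , λ _ → ≤-refl

-- Two entries of `π` suffice. The first of its upward block rises by `suc y`, which is impossible
-- left of `a′` and at most `p′`; the last has the greatest value below the end of the blocks and
-- also rises, so it stays below the end for `σ`.
≤ᴮ⇒bounds : ∀ (π σ : Permutation′ n) a y z a′ p′ q′ →
  ext π ≗ blockSwap a (suc y) (suc z) → ext σ ≗ blockSwap a′ p′ q′ → π ≤ᴮ σ →
  a′ ≤ a × suc y ≤ p′ × a + suc y + suc z ≤ a′ + p′ + q′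
≤ᴮ⇒bounds π σ a y z a′ p′ q′ π≗ σ≗ π≤σ = a′≤a , p≤p′ , c≤c′
  where
  bounded : ∀ {i v} → Swap a (suc y) (suc z) i v → Bounded a′ p′ (a′ + p′ + q′) i v
  bounded s = subst (Bounded a′ p′ (a′ + p′ + q′) _) (ext-value π π≗ s)
    (≤ᴮ-invariant (Bounded a′ p′ (a′ + p′ + q′)) bounded-mono π σ π≤σ
      (λ k → subst (Bounded a′ p′ (a′ + p′ + q′) k) (sym (σ≗ k))
        (swap-bounded (swap-blockSwap a′ p′ q′ k))) _)
  first : Bounded a′ p′ (a′ + p′ + q′) (a + 0) (a + suc y + 0)
  first = bounded (up z<s)
  last : Bounded a′ p′ (a′ + p′ + q′) (a + z) (a + suc y + z)
  last = bounded (up ≤-refl)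
  a′≤a : a′ ≤ a
  a′≤a = ≮⇒≥ λ a<a′ →
    ⊥-by y (proj₁ first (subst (_< a′) (sym (+-identityʳ a)) a<a′)) (solve (a ∷ y ∷ []))
  p≤p′ : suc y ≤ p′
  p≤p′ = ≤-by (proj₁ (proj₂ first)) (solve (a ∷ y ∷ p′ ∷ []))
  c≤c′ : a + suc y + suc z ≤ a′ + p′ + q′
  c≤c′ = ≤-trans (≤-reflexive (+-suc (a + suc y) z))
    (≰⇒> λ c′≤v → ⊥-by y (proj₂ (proj₂ last) c′≤v) (solve (a ∷ y ∷ z ∷ [])))

-- Pairs of natural numbers

private
  variable
    u v v′ o o′ i i′ : ℕ × ℕ

infix 4 _↗_
data _↗_ : (v v′ : ℕ × ℕ) → Set where
  fst↗ : ∀ {x y} → (x , y) ↗ (suc x , y)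
  snd↗ : ∀ {x y} → (x , y) ↗ (x , suc y)

sum : ℕ × ℕ → ℕ
sum (x , y) = x + y

-- The number of unit increments among the unit moves needed from v to v′; the
-- number of decrements is climb v′ v, and v′ ≤ v componentwise is climb v v′ ≡ 0.
climb : (v v′ : ℕ × ℕ) → ℕ
climb (x , y) (x′ , y′) = (x′ ∸ x) + (y′ ∸ y)

gap : (v v′ : ℕ × ℕ) → ℕ
gap (x , y) (x′ , y′) = ∣ x - x′ ∣ + ∣ y - y′ ∣

∸-step : ∀ {m n} → m < n → n ∸ m ≡ suc (n ∸ suc m)
∸-step {m} {n} m<n = +-∸-assoc 1 {n} {suc m} m<n

climb≡0 : ∀ v v′ → climb v v′ ≡ 0 → proj₁ v′ ≤ proj₁ v × proj₂ v′ ≤ proj₂ v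
climb≡0 (x , y) (x′ , y′) eq =
  m∸n≡0⇒m≤n (m+n≡0⇒m≡0 (x′ ∸ x) eq) , m∸n≡0⇒m≤n (m+n≡0⇒n≡0 (x′ ∸ x) eq)

≤⇒climb≡0 : proj₁ v′ ≤ proj₁ v → proj₂ v′ ≤ proj₂ v → climb v v′ ≡ 0
≤⇒climb≡0 x′≤x y′≤y = cong₂ _+_ (m≤n⇒m∸n≡0 x′≤x) (m≤n⇒m∸n≡0 y′≤y)

climb-antisym : ∀ v v′ → climb v v′ ≡ 0 → climb v′ v ≡ 0 → v ≡ v′
climb-antisym v v′ asc desc with climb≡0 v v′ asc | climb≡0 v′ v desc
... | x′≤x , y′≤y | x≤x′ , y≤y′ = cong₂ _,_ (≤-antisym x≤x′ x′≤x) (≤-antisym y≤y′ y′≤y)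

climb-balance : ∀ v v′ → sum v + climb v v′ ≡ sum v′ + climb v′ v
climb-balance (x , y) (x′ , y′) = begin
  x + y + ((x′ ∸ x) + (y′ ∸ y))   ≡⟨ +-interchange x y (x′ ∸ x) (y′ ∸ y) ⟩
  x + (x′ ∸ x) + (y + (y′ ∸ y))   ≡⟨ cong₂ _+_ (m+[n∸m]≡n+[m∸n] x x′) (m+[n∸m]≡n+[m∸n] y y′) ⟩
  x′ + (x ∸ x′) + (y′ + (y ∸ y′)) ≡⟨ +-interchange x′ y′ (x ∸ x′) (y ∸ y′) ⟨
  x′ + y′ + ((x ∸ x′) + (y ∸ y′)) ∎
  where
  open ≡-Reasoning
  m+[n∸m]≡n+[m∸n] : ∀ m n → m + (n ∸ m) ≡ n + (m ∸ n)
  m+[n∸m]≡n+[m∸n] zero n = sym (trans (cong (n +_) (0∸n≡0 n)) (+-identityʳ n))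
  m+[n∸m]≡n+[m∸n] (suc m) zero = +-identityʳ (suc m)
  m+[n∸m]≡n+[m∸n] (suc m) (suc n) = cong suc (m+[n∸m]≡n+[m∸n] m n)

climb-gap : ∀ v v′ → climb v v′ + climb v′ v ≡ gap v v′
climb-gap (x , y) (x′ , y′) = trans (+-interchange (x′ ∸ x) (y′ ∸ y) (x ∸ x′) (y ∸ y′))
  (cong₂ _+_ ([n∸m]+[m∸n] x x′) ([n∸m]+[m∸n] y y′))
  where
  [n∸m]+[m∸n] : ∀ m n → (n ∸ m) + (m ∸ n) ≡ ∣ m - n ∣
  [n∸m]+[m∸n] zero n = trans (cong (n +_) (0∸n≡0 n)) (+-identityʳ n)
  [n∸m]+[m∸n] (suc m) zero = refl
  [n∸m]+[m∸n] (suc m) (suc n) = [n∸m]+[m∸n] m n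

gap-triangle : ∀ u v w → gap u w ≤ gap u v + gap v w
gap-triangle (x , y) (x′ , y′) (x″ , y″) = ≤-by
  (∣-∣-triangle x x′ x″ ⊕ ∣-∣-triangle y y′ y″)
  (rearrange ∣ x - x″ ∣ ∣ y - y″ ∣ ∣ x - x′ ∣ ∣ y - y′ ∣ ∣ x′ - x″ ∣ ∣ y′ - y″ ∣)
  where
  rearrange : ∀ a b c d e f → (a + b) + ((c + e) + (d + f)) ≡ (c + d) + (e + f) + (a + b)
  rearrange a b c d e f = solve (a ∷ b ∷ c ∷ d ∷ e ∷ f ∷ [])

gap-refl : ∀ v → gap v v ≡ 0
gap-refl (x , y) = cong₂ _+_ (∣n-n∣≡0 x) (∣n-n∣≡0 y)

↗⇒sum : v ↗ v′ → sum v′ ≡ suc (sum v)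
↗⇒sum fst↗ = refl
↗⇒sum (snd↗ {x} {y}) = +-suc x y

1+n∸n≡1 : ∀ m → suc m ∸ m ≡ 1
1+n∸n≡1 m = m+n∸n≡m 1 m

↗⇒climb≡1 : v ↗ v′ → climb v v′ ≡ 1
↗⇒climb≡1 (fst↗ {x} {y}) = cong₂ _+_ (1+n∸n≡1 x) (n∸n≡0 y)
↗⇒climb≡1 (snd↗ {x} {y}) = cong₂ _+_ (n∸n≡0 x) (1+n∸n≡1 y)

↗⇒climb≡0 : v ↗ v′ → climb v′ v ≡ 0
↗⇒climb≡0 (fst↗ {x} {y}) = cong₂ _+_ (m≤n⇒m∸n≡0 (n≤1+n x)) (n∸n≡0 y)
↗⇒climb≡0 (snd↗ {x} {y}) = cong₂ _+_ (n∸n≡0 x) (m≤n⇒m∸n≡0 (n≤1+n y))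

↗⇒gap : v ↗ v′ → gap v v′ ≡ 1
↗⇒gap {v} {v′} v↗v′ = trans (sym (climb-gap v v′)) (cong₂ _+_ (↗⇒climb≡1 v↗v′) (↗⇒climb≡0 v↗v′))

↗⇒gap′ : v ↗ v′ → gap v′ v ≡ 1
↗⇒gap′ {v} {v′} v↗v′ = trans (sym (climb-gap v′ v)) (cong₂ _+_ (↗⇒climb≡0 v↗v′) (↗⇒climb≡1 v↗v′))

-- A needed increment is used up without creating a needed decrement, so inductions can count both
-- kinds separately.
rise : ∀ v v′ {k} → climb v v′ ≡ suc k →
  ∃ λ u → v ↗ u × climb u v′ ≡ k × climb v′ u ≡ climb v′ v
rise (x , y) (x′ , y′) eq with x <? x′
... | yes x<x′ = (suc x , y) , fst↗ ,
  suc-injective (trans (cong (_+ (y′ ∸ y)) (sym (∸-step x<x′))) eq) ,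
  cong (_+ (y ∸ y′)) (trans (m≤n⇒m∸n≡0 x<x′) (sym (m≤n⇒m∸n≡0 (<⇒≤ x<x′))))
... | no x≮x′ with y <? y′
... | yes y<y′ = (x , suc y) , snd↗ ,
  suc-injective (trans (sym (+-suc (x′ ∸ x) (y′ ∸ suc y)))
    (trans (cong ((x′ ∸ x) +_) (sym (∸-step y<y′))) eq)) ,
  cong ((x ∸ x′) +_) (trans (m≤n⇒m∸n≡0 y<y′) (sym (m≤n⇒m∸n≡0 (<⇒≤ y<y′))))
... | no y≮y′ = contradiction
  (trans (sym (≤⇒climb≡0 {x′ , y′} {x , y} (≮⇒≥ x≮x′) (≮⇒≥ y≮y′))) eq) λ ()

fall : ∀ v v′ {k} → climb v′ v ≡ suc k →
  ∃ λ u → u ↗ v × climb v′ u ≡ k × climb u v′ ≡ climb v v′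
fall (x , y) (x′ , y′) eq with x′ <? x
fall (suc x , y) (x′ , y′) eq | yes (s≤s x′≤x) = (x , y) , fst↗ ,
  suc-injective (trans (cong (_+ (y ∸ y′)) (sym (+-∸-assoc 1 x′≤x))) eq) ,
  cong (_+ (y′ ∸ y)) (trans (m≤n⇒m∸n≡0 x′≤x) (sym (m≤n⇒m∸n≡0 (m≤n⇒m≤1+n x′≤x))))
... | no x′≮x with y′ <? y
fall (x , suc y) (x′ , y′) eq | no _ | yes (s≤s y′≤y) = (x , y) , snd↗ ,
  suc-injective (trans (sym (+-suc (x ∸ x′) (y ∸ y′)))
    (trans (cong ((x ∸ x′) +_) (sym (+-∸-assoc 1 y′≤y))) eq)) ,
  cong ((x′ ∸ x) +_) (trans (m≤n⇒m∸n≡0 y′≤y) (sym (m≤n⇒m∸n≡0 (m≤n⇒m≤1+n y′≤y))))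
... | no y′≮y = contradiction
  (trans (sym (≤⇒climb≡0 {x , y} {x′ , y′} (≮⇒≥ x′≮x) (≮⇒≥ y′≮y))) eq) λ ()

↗-sandwich : v ↗ v′ → climb u v ≡ 0 → climb v′ u ≡ 0 → u ≡ v ⊎ u ≡ v′
↗-sandwich {u = u} (fst↗ {x} {y}) below above
  with climb≡0 u (x , y) below | climb≡0 (suc x , y) u above
... | x≤ , y≤ | ≤x , ≤y with m≤n⇒m<n∨m≡n ≤x
... | inj₁ (s≤s u≤x) = inj₁ (cong₂ _,_ (≤-antisym u≤x x≤) (≤-antisym ≤y y≤))
... | inj₂ u≡x = inj₂ (cong₂ _,_ u≡x (≤-antisym ≤y y≤))
↗-sandwich {u = u} (snd↗ {x} {y}) below above
  with climb≡0 u (x , y) below | climb≡0 (x , suc y) u above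
... | x≤ , y≤ | ≤x , ≤y with m≤n⇒m<n∨m≡n ≤y
... | inj₁ (s≤s u≤y) = inj₁ (cong₂ _,_ (≤-antisym ≤x x≤) (≤-antisym u≤y y≤))
... | inj₂ u≡y = inj₂ (cong₂ _,_ (≤-antisym ≤x x≤) u≡y)

-- With equal sums `climb-balance` makes increments and decrements equally many, so the absence of
-- one kind excludes the other.
climb-sum : ∀ v v′ → climb v v′ ≡ 0 → sum v ≡ sum v′ → v ≡ v′
climb-sum v v′ desc eq = climb-antisym v v′ desc
  (+-cancelˡ-≡ (sum v′) _ _ (trans (sym (climb-balance v v′)) (trans (cong₂ _+_ eq desc) refl)))

-- Shapes of bigrassmannian permutations

-- With length vector (ℓ₁, ℓ₂, ℓ₃, ℓ₄), o = (ℓ₁ - 1, ℓ₄ - 1) and i = (ℓ₂ - 1, ℓ₃ - 1).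
record HasShape (π : 𝔅 n) (o i : ℕ × ℕ) : Set where
  constructor hasShape
  field
    blocks : ext (proj₁ π) ≗ blockSwap (proj₁ o) (suc (proj₁ i)) (suc (proj₂ i))
    total : sum o + sum i + 2 ≡ n

open HasShape

-- The constant 2 comes from the sizes `suc y` and `suc z`; `t` counts the fixed points after the
-- blocks.
shape-total : ∀ a y z t → a + t + (y + z) + 2 ≡ a + suc y + suc z + t
shape-total a y z t = solve (a ∷ y ∷ z ∷ t ∷ [])

abstract
  realise : ∀ o i → sum o + sum i + 2 ≡ n → ∃ λ (π : 𝔅 n) → HasShape π o i
  realise {n} (a , t) (y , z) total =
    let σ , σ≗ = blockPermutation a (suc y) (suc z) c≤n
    in (σ , blockSwap-bigrassmannian σ a y z σ≗) , hasShape σ≗ total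
    where
    c≤n : a + suc y + suc z ≤ n
    c≤n = m+n≤o⇒m≤o _ (≤-reflexive (trans (sym (shape-total a y z t)) total))

  shape : ∀ (π : 𝔅 n) → ∃₂ (HasShape π)
  shape {n} (σ , big) =
    let a , y , z , c≤n , σ≗ = bigrassmannian⇒blockSwap σ big
        t , n≡c+t = ≤⇒+ c≤n
    in (a , t) , (y , z) , hasShape σ≗ (trans (shape-total a y z t) (sym n≡c+t))

shapes-total : ∀ {π σ : 𝔅 n} → HasShape π o i → HasShape σ o′ i′ →
  sum o + sum i ≡ sum o′ + sum i′
shapes-total {o = o} {i = i} πs σs = +-cancelʳ-≡ 2 _ _ (trans (total πs) (sym (total σs)))

shapes-balance : ∀ {π σ : 𝔅 n} → HasShape π o i → HasShape σ o′ i′ →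
  climb o o′ + climb i i′ ≡ climb o′ o + climb i′ i
shapes-balance {o = o} {i = i} {o′ = o′} {i′ = i′} πs σs = +-cancelˡ-≡ (sum o + sum i) _ _ (begin
  sum o + sum i + (climb o o′ + climb i i′)     ≡⟨ +-interchange (sum o) (sum i) _ _ ⟩
  sum o + climb o o′ + (sum i + climb i i′)
    ≡⟨ cong₂ _+_ (climb-balance o o′) (climb-balance i i′) ⟩
  sum o′ + climb o′ o + (sum i′ + climb i′ i)   ≡⟨ +-interchange (sum o′) (sum i′) _ _ ⟨
  sum o′ + sum i′ + (climb o′ o + climb i′ i)
    ≡⟨ cong (_+ (climb o′ o + climb i′ i)) (shapes-total πs σs) ⟨
  sum o + sum i + (climb o′ o + climb i′ i)     ∎)
  where
  open ≡-Reasoning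

shape⇒≈ : ∀ {π σ : 𝔅 n} → HasShape π o i → HasShape σ o i → π ≈𝔅 σ
shape⇒≈ {π = π} {σ} πs σs = ext-injective (proj₁ π) (proj₁ σ)
  (λ k → trans (blocks πs k) (sym (blocks σs k)))

-- The inverses supply the comparison of `z` and `z′`. The two totals agree, so the comparison of
-- block ends becomes `t′ ≤ t`.
≤⇒climb : ∀ {π σ : 𝔅 n} → HasShape π o i → HasShape σ o′ i′ → π ≤𝔅 σ →
  climb o o′ ≡ 0 × climb i′ i ≡ 0
≤⇒climb {o = a , t} {i = y , z} {o′ = a′ , t′} {i′ = y′ , z′} {π = π , _} {σ , _} πs σs π≤σ
  with ≤ᴮ⇒bounds π σ a y z a′ (suc y′) (suc z′) (blocks πs) (blocks σs) π≤σ
     | ≤ᴮ⇒bounds (flip π) (flip σ) a z y a′ (suc z′) (suc y′)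
         (ext-flip-blockSwap π a (suc y) (suc z) (blocks πs))
         (ext-flip-blockSwap σ a′ (suc y′) (suc z′) (blocks σs)) (≤ᴮ-flip π σ π≤σ)
... | a′≤a , s≤s y≤y′ , c≤c′ | _ , s≤s z≤z′ , _ =
  ≤⇒climb≡0 {a′ , t′} {a , t} a′≤a t′≤t , ≤⇒climb≡0 {y , z} {y′ , z′} y≤y′ z≤z′
  where
  totals : a′ + t′ + (y′ + z′) + 2 ≤ a + t + (y + z) + 2
  totals = ≤-reflexive (trans (total σs) (sym (total πs)))
  t′≤t : t′ ≤ t
  t′≤t = ≤-by (c≤c′ ⊕ totals)
    (solve (a ∷ t ∷ y ∷ z ∷ a′ ∷ t′ ∷ y′ ∷ z′ ∷ []))

≈⇒shape : ∀ {π σ : 𝔅 n} → HasShape π o i → HasShape σ o′ i′ → π ≈𝔅 σ → o ≡ o′ × i ≡ i′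
≈⇒shape {π = π} {σ} πs σs π≈σ
  = climb-antisym _ _ (proj₁ π≤σ) (proj₁ σ≤π) , climb-antisym _ _ (proj₂ σ≤π) (proj₂ π≤σ)
  where
  π≤σ = ≤⇒climb πs σs (≤ᴮ-reflexive (proj₁ π) (proj₁ σ) π≈σ)
  σ≤π = ≤⇒climb σs πs (≤ᴮ-reflexive (proj₁ σ) (proj₁ π) (sym ∘ π≈σ))

unit⇒≤ : ∀ {π σ : 𝔅 n} → HasShape π o i → HasShape σ o′ i′ → o′ ↗ o → i ↗ i′ → π ≤𝔅 σ
unit⇒≤ {π = π , _} {σ , _} πs σs (fst↗ {a}) (fst↗ {y} {z}) =
  shrink-p-raise-a σ π a (suc y) (suc z) (blocks σs) (blocks πs)
unit⇒≤ {π = π , _} {σ , _} πs σs (fst↗ {a}) (snd↗ {y} {z}) =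
  shrink-q-raise-a σ π a (suc y) (suc z) (blocks σs) (blocks πs)
unit⇒≤ {π = π , _} {σ , _} πs σs (snd↗ {a}) (fst↗ {y} {z}) =
  shrink-p σ π a (suc y) (suc z) (blocks σs) (blocks πs)
unit⇒≤ {π = π , _} {σ , _} πs σs (snd↗ {a}) (snd↗ {y} {z}) =
  shrink-q σ π a (suc y) (suc z) (blocks σs) (blocks πs)

neighbour-total : ∀ {o o′ i i′} → o ↗ o′ → i′ ↗ i → sum o′ + sum i′ ≡ sum o + sum i
neighbour-total {o} {o′} {i} {i′} o↗ i↗ = trans (cong (_+ sum i′) (↗⇒sum o↗))
  (trans (sym (+-suc (sum o) (sum i′))) (cong (sum o +_) (sym (↗⇒sum i↗))))

climb⇒≤ : ∀ k {π σ : 𝔅 n} → HasShape π o i → HasShape σ o′ i′ →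
  climb o′ o ≡ k → climb i i′ ≡ k → climb o o′ ≡ 0 → climb i′ i ≡ 0 → π ≤𝔅 σ
climb⇒≤ {o = o} {i = i} {o′ = o′} {i′ = i′} zero {π} {σ} πs σs up₁ down₂ down₁ up₂
  with refl ← climb-antisym o o′ down₁ up₁ | refl ← climb-antisym i i′ down₂ up₂ =
  ≤ᴮ-reflexive (proj₁ π) (proj₁ σ) (shape⇒≈ πs σs)
climb⇒≤ {o = o} {i = i} {o′ = o′} {i′ = i′} (suc k) {π} {σ} πs σs up₁ down₂ down₁ up₂
  with o₁ , o′↗o₁ , up₁′ , down₁′ ← rise o′ o up₁ | i₁ , i₁↗i′ , down₂′ , up₂′ ← fall i′ i down₂
  with ρ , ρs ← realise o₁ i₁ (trans (cong (_+ 2) (neighbour-total o′↗o₁ i₁↗i′)) (total σs)) =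
  ≤ᴮ-trans (proj₁ π) (proj₁ ρ) (proj₁ σ)
    (climb⇒≤ k πs ρs up₁′ down₂′ (trans down₁′ down₁) (trans up₂′ up₂))
    (unit⇒≤ ρs σs o′↗o₁ i₁↗i′)

unit⇒< : ∀ {π σ : 𝔅 n} → HasShape π o i → HasShape σ o′ i′ → o′ ↗ o → i ↗ i′ → π <𝔅 σ
unit⇒< πs σs o′↗o i↗i′ = unit⇒≤ πs σs o′↗o i↗i′ , λ π≈σ →
  1+n≢n (trans (sym (↗⇒sum o′↗o)) (cong sum (proj₁ (≈⇒shape πs σs π≈σ))))

-- The outer pair of an element in between is squeezed onto one of the two ends. The total then
-- fixes the sum of its inner pair, and `climb-sum` the pair itself, so the element is an endpoint.
unit⇒⋖ : ∀ {π σ : 𝔅 n} → HasShape π o i → HasShape σ o′ i′ → o′ ↗ o → i ↗ i′ → π ⋖ σ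
unit⇒⋖ {o = o} {i = i} {o′ = o′} {i′ = i′} {π} {σ} πs σs o′↗o i↗i′ =
  unit⇒< πs σs o′↗o i↗i′ , λ { (ρ , (π≤ρ , π≉ρ) , (ρ≤σ , ρ≉σ)) → none ρ π≤ρ π≉ρ ρ≤σ ρ≉σ }
  where
  none : ∀ ρ → π ≤𝔅 ρ → ¬ π ≈𝔅 ρ → ρ ≤𝔅 σ → ¬ ρ ≈𝔅 σ → ⊥
  none ρ π≤ρ π≉ρ ρ≤σ ρ≉σ with r , s , ρs ← shape ρ
    with ≤⇒climb πs ρs π≤ρ | ≤⇒climb ρs σs ρ≤σ
  ... | o≽r , s≽i | r≽o′ , i′≽s with ↗-sandwich o′↗o r≽o′ o≽r
  ... | inj₁ refl
    with refl ← climb-sum i′ s i′≽s (sym (+-cancelˡ-≡ (sum r) _ _ (shapes-total ρs σs))) =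
    ρ≉σ (shape⇒≈ ρs σs)
  ... | inj₂ refl
    with refl ← climb-sum s i s≽i (+-cancelˡ-≡ (sum r) _ _ (shapes-total ρs πs)) =
    π≉ρ (shape⇒≈ πs ρs)

-- By the balance both pairs need the same number of unit moves. If there are two or more, the
-- element one unit below `σ` lies strictly between.
⋖⇒unit : ∀ {π σ : 𝔅 n} → HasShape π o i → HasShape σ o′ i′ → π ⋖ σ → o′ ↗ o × i ↗ i′
⋖⇒unit {o = o} {i = i} {o′ = o′} {i′ = i′} {π = π} {σ} πs σs ((π≤σ , π≉σ) , no-between)
  with down₁ , up₂ ← ≤⇒climb πs σs π≤σ = from-climb (climb o′ o) refl down₂
  where
  down₂ : climb i i′ ≡ climb o′ o
  down₂ = trans (cong (_+ climb i i′) (sym down₁)) (trans (shapes-balance πs σs)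
    (trans (cong (climb o′ o +_) up₂) (+-identityʳ (climb o′ o))))
  from-climb : ∀ k → climb o′ o ≡ k → climb i i′ ≡ k → o′ ↗ o × i ↗ i′
  from-climb zero up₁ down₂
    with refl ← climb-antisym o o′ down₁ up₁ | refl ← climb-antisym i i′ down₂ up₂ =
    contradiction (shape⇒≈ πs σs) π≉σ
  from-climb (suc k) up₁ down₂
    with o₁ , o′↗o₁ , up₁′ , down₁′ ← rise o′ o up₁ | i₁ , i₁↗i′ , down₂′ , up₂′ ← fall i′ i down₂
    with k
  ... | zero with refl ← climb-antisym o₁ o up₁′ (trans down₁′ down₁)
                | refl ← climb-antisym i i₁ down₂′ (trans up₂′ up₂) = o′↗o₁ , i₁↗i′
  ... | suc k
    with ρ , ρs ← realise o₁ i₁ (trans (cong (_+ 2) (neighbour-total o′↗o₁ i₁↗i′)) (total σs)) =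
    contradiction
      (ρ , (climb⇒≤ (suc k) πs ρs up₁′ down₂′ (trans down₁′ down₁) (trans up₂′ up₂) ,
            λ π≈ρ → contradiction
              (trans (sym up₁′) (proj₁ (≤⇒climb ρs πs
                (≤ᴮ-reflexive (proj₁ ρ) (proj₁ π) (sym ∘ π≈ρ)))))
              λ ()) ,
           unit⇒< ρs σs o′↗o₁ i₁↗i′)
      no-between

-- Walks

abstract
  edge-down : ∀ {π : 𝔅 n} → HasShape π o i → o ↗ o′ → i′ ↗ i →
    ∃ λ ρ → HasShape ρ o′ i′ × ρ ⋖ π
  edge-down {o′ = o′} {i′ = i′} πs o↗o′ i′↗i =
    let ρ , ρs = realise o′ i′ (trans (cong (_+ 2) (neighbour-total o↗o′ i′↗i)) (total πs))
    in ρ , ρs , unit⇒⋖ ρs πs o↗o′ i′↗i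

  edge-up : ∀ {π : 𝔅 n} → HasShape π o i → o′ ↗ o → i ↗ i′ →
    ∃ λ ρ → HasShape ρ o′ i′ × π ⋖ ρ
  edge-up {o′ = o′} {i′ = i′} πs o′↗o i↗i′ =
    let ρ , ρs = realise o′ i′ (trans (cong (_+ 2) (sym (neighbour-total o′↗o i↗i′))) (total πs))
    in ρ , ρs , unit⇒⋖ πs ρs o′↗o i↗i′

-- Each edge serves a needed move in both pairs as long as possible. Once one
-- pair is in place, the other needs equally many increments and decrements,
-- and the finished pair steps away and back, upwards first so as to stay in ℕ.
walk : ∀ u₁ d₁ u₂ d₂ {π σ : 𝔅 n} {o i o′ i′} → HasShape π o i → HasShape σ o′ i′ →
  climb o o′ ≡ u₁ → climb o′ o ≡ d₁ → climb i i′ ≡ u₂ → climb i′ i ≡ d₂ →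
  u₁ + u₂ ≡ d₁ + d₂ → Walk ((u₁ + d₁) ⊔ (u₂ + d₂)) π σ
walk (suc u₁) d₁ u₂ (suc d₂) {π} {σ} {o} {i} {o′} {i′} πs σs o↗ o↘ i↗ i↘ eq =
  let o₁ , o↗o₁ , up₁ , down₁ = rise o o′ o↗
      i₁ , i₁↗i , down₂ , up₂ = fall i i′ i↘
      ρ , ρs , ρ⋖π = edge-down πs o↗o₁ i₁↗i
  in subst (λ k → Walk ((suc u₁ + d₁) ⊔ k) π σ) (sym (+-suc u₂ d₂))
    (step (inj₂ ρ⋖π) (walk u₁ d₁ u₂ d₂ ρs σs up₁ (trans down₁ o↘) (trans up₂ i↗) down₂
      (suc-injective (trans eq (+-suc d₁ d₂)))))
walk u₁ (suc d₁) (suc u₂) d₂ {π} {σ} {o} {i} {o′} {i′} πs σs o↗ o↘ i↗ i↘ eq =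
  let o₁ , o₁↗o , down₁ , up₁ = fall o o′ o↘
      i₁ , i↗i₁ , up₂ , down₂ = rise i i′ i↗
      ρ , ρs , π⋖ρ = edge-up πs o₁↗o i↗i₁
  in subst (λ k → Walk (k ⊔ (suc u₂ + d₂)) π σ) (sym (+-suc u₁ d₁))
    (step (inj₁ π⋖ρ) (walk u₁ d₁ u₂ d₂ ρs σs (trans up₁ o↗) down₁ up₂ (trans down₂ i↘)
      (suc-injective (trans (sym (+-suc u₁ u₂)) eq))))
walk zero zero zero zero {π} {σ} {o} {i} {o′} {i′} πs σs o↗ o↘ i↗ i↘ _ =
  stop (shape⇒≈ πs (subst₂ (HasShape _)
    (climb-antisym o′ o o↘ o↗) (climb-antisym i′ i i↘ i↗) σs))
walk zero zero (suc u₂) (suc .u₂) {π} {σ} {o} {i} {o′} {i′} πs σs o↗ o↘ i↗ i↘ refl =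
  let i₁ , i₁↗i , down₂ , up₂ = fall i i′ i↘
      ρ , ρs , ρ⋖π = edge-down πs fst↗ i₁↗i
      i₂ , i₁↗i₂ , up₂′ , down₂′ = rise i₁ i′ (trans up₂ i↗)
      ρ′ , ρ′s , ρ⋖ρ′ = edge-up ρs fst↗ i₁↗i₂
  in subst (λ k → Walk k π σ) (cong suc (sym (+-suc u₂ u₂)))
    (step {ρ = ρ} (inj₂ ρ⋖π) (step {ρ = ρ′} (inj₁ ρ⋖ρ′)
      (walk zero zero u₂ u₂ ρ′s σs o↗ o↘ up₂′ (trans down₂′ down₂) refl)))
walk (suc u₁) (suc d₁) zero zero {π} {σ} {o} {i} {o′} {i′} πs σs o↗ o↘ i↗ i↘ eq =
  let o₁ , o₁↗o , down₁ , up₁ = fall o o′ o↘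
      ρ , ρs , π⋖ρ = edge-up πs o₁↗o fst↗
      o₂ , o₁↗o₂ , up₁′ , down₁′ = rise o₁ o′ (trans up₁ o↗)
      ρ′ , ρ′s , ρ′⋖ρ = edge-down ρs o₁↗o₂ fst↗
  in subst (λ k → Walk k π σ)
    (trans (cong (2 +_) (⊔-identityʳ (u₁ + d₁))) (cong suc (sym (+-suc u₁ d₁))))
    (step {ρ = ρ} (inj₁ π⋖ρ) (step {ρ = ρ′} (inj₂ ρ′⋖ρ)
      (walk u₁ d₁ zero zero ρ′s σs up₁′ (trans down₁′ down₁) i↗ i↘ (suc-injective eq))))

edge-gap : ∀ {π σ : 𝔅 n} → HasShape π o i → HasShape σ o′ i′ → HasseEdge π σ →
  gap o o′ ≡ 1 × gap i i′ ≡ 1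
edge-gap πs σs (inj₁ π⋖σ) =
  let o′↗o , i↗i′ = ⋖⇒unit πs σs π⋖σ in ↗⇒gap′ o′↗o , ↗⇒gap i↗i′
edge-gap πs σs (inj₂ σ⋖π) =
  let o↗o′ , i′↗i = ⋖⇒unit σs πs σ⋖π in ↗⇒gap o↗o′ , ↗⇒gap′ i′↗i

walk-gap : ∀ {k} {π σ : 𝔅 n} {o i o′ i′} → HasShape π o i → HasShape σ o′ i′ → Walk k π σ →
  gap o o′ ≤ k × gap i i′ ≤ k
walk-gap {o = o} {i} πs σs (stop π≈σ) =
  let o≡o′ , i≡i′ = ≈⇒shape πs σs π≈σ
  in ≤-reflexive (trans (cong (gap o) (sym o≡o′)) (gap-refl o)) ,
     ≤-reflexive (trans (cong (gap i) (sym i≡i′)) (gap-refl i))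
walk-gap {o = o} {i} {o′} {i′} πs σs (step {ρ = ρ} edge rest) =
  let r , s , ρs = shape ρ
      o~r , i~s = edge-gap πs ρs edge
      r~o′ , s~i′ = walk-gap ρs σs rest
  in ≤-trans (gap-triangle o r o′) (≤-reflexive o~r ⊕ r~o′) ,
     ≤-trans (gap-triangle i s i′) (≤-reflexive i~s ⊕ s~i′)

distance : ∀ {π σ : 𝔅 n} → HasShape π o i → HasShape σ o′ i′ →
  IsDistance π σ (gap o o′ ⊔ gap i i′)
distance {o = o} {i} {o′} {i′} {π} {σ} πs σs =
  subst (λ k → Walk k π σ) (cong₂ _⊔_ (climb-gap o o′) (climb-gap i i′))
    (walk _ _ _ _ πs σs refl refl refl refl (shapes-balance πs σs)) ,
  λ k π→σ → ⊔-lub (proj₁ (walk-gap πs σs π→σ)) (proj₂ (walk-gap πs σs π→σ))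

-- Length vectors

-- A default value makes lookup total, so equal lists can be compared entry by entry without proofs
-- about lengths.
nth : List ℕ → ℕ → ℕ
nth [] _ = 0
nth (x ∷ xs) zero = x
nth (x ∷ xs) (suc k) = nth xs k

nth-tabulate : (f : Fin n → ℕ) (i : Fin n) → nth (tabulate f) (toℕ i) ≡ f i
nth-tabulate f Fin.zero = refl
nth-tabulate f (Fin.suc i) = nth-tabulate (f ∘ Fin.suc) i

nth-applyUpTo : ∀ (f : ℕ → ℕ) {m} {xs} {k} → k < m → nth (applyUpTo f m ++ xs) k ≡ f k
nth-applyUpTo f {suc m} {k = zero} _ = refl
nth-applyUpTo f {suc m} {k = suc k} (s≤s k<m) = nth-applyUpTo (f ∘ suc) k<m

nth-beyond : ∀ (f : ℕ → ℕ) m {xs} k → nth (applyUpTo f m ++ xs) (m + k) ≡ nth xs k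
nth-beyond f zero k = refl
nth-beyond f (suc m) k = nth-beyond (f ∘ suc) m k

swap-nth : ∀ {a p q n k v} → k < n → Swap a p q k v →
  nth (1 ⋯ a ++ suc (a + p) ⋯ (a + p + q) ++ suc a ⋯ (a + p) ++ suc (a + p + q) ⋯ n) k ≡ suc v
-- The rewrites turn the lengths of the two middle runs into `q` and `p`.
swap-nth {a} {p} {q} {n} k<n s rewrite m+n∸m≡n (a + p) q | m+n∸m≡n a p = go k<n s
  where
  block₄ = applyUpTo (suc (a + p + q) +_) (n ∸ (a + p + q))
  block₃ = applyUpTo (suc a +_) p ++ block₄
  block₂ = applyUpTo (suc (a + p) +_) q ++ block₃
  go : ∀ {k v} → k < n → Swap a p q k v → nth (applyUpTo (1 +_) a ++ block₂) k ≡ suc v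
  go _ (left k<a) = nth-applyUpTo (1 +_) k<a
  go _ (up {j} j<q) =
    trans (nth-beyond (1 +_) a j) (nth-applyUpTo (suc (a + p) +_) j<q)
  go _ (down {j} j<p) =
    trans (cong (nth (applyUpTo (1 +_) a ++ block₂)) (+-assoc a q j))
    (trans (nth-beyond (1 +_) a (q + j))
    (trans (nth-beyond (suc (a + p) +_) q j) (nth-applyUpTo (suc a +_) j<p)))
  go k<n (right c≤k) with j , refl ← ≤⇒+ c≤k =
    trans (cong (nth (applyUpTo (1 +_) a ++ block₂)) k≡)
    (trans (nth-beyond (1 +_) a (q + (p + j)))
    (trans (nth-beyond (suc (a + p) +_) q (p + j))
    (trans (nth-beyond (suc a +_) p j)
    (trans (cong (λ xs → nth xs j) (sym (++-identityʳ block₄)))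
      (nth-applyUpTo (suc (a + p + q) +_) j<)))))
    where
    k≡ : a + p + q + j ≡ a + (q + (p + j))
    k≡ = solve (a ∷ p ∷ q ∷ j ∷ [])
    j< : j < n ∸ (a + p + q)
    j< = +-cancelˡ-< (a + p + q) _ _
      (≤-trans k<n (≤-reflexive (sym (m+[n∸m]≡n (≤-trans (m≤m+n _ j) (<⇒≤ k<n))))))

oneLine⇒blockSwap : ∀ (σ : Permutation′ n) a p q → a + p + q ≤ n →
  oneLine σ ≡ 1 ⋯ a ++ suc (a + p) ⋯ (a + p + q) ++ suc a ⋯ (a + p) ++ suc (a + p + q) ⋯ n →
  ext σ ≗ blockSwap a p q
oneLine⇒blockSwap {n} σ a p q c≤n eq k with position n k
... | outside n≤k = trans (ext-fixes σ k n≤k) (sym (swap⇒≡ {a} {p} {q} (right (≤-trans c≤n n≤k))))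
... | inside i = trans (ext-toℕ σ i) (suc-injective (trans (sym (nth-tabulate _ i))
  (trans (cong (λ xs → nth xs (toℕ i)) eq) (swap-nth (toℕ<n i) (swap-blockSwap a p q (toℕ i))))))

lengthVector⇒shape : ∀ (π : 𝔅 n) {ℓ₁ ℓ₂ ℓ₃ ℓ₄} → HasLengthVector π ℓ₁ ℓ₂ ℓ₃ ℓ₄ →
  ∃ λ a → ∃ λ t → ∃ λ y → ∃ λ z → HasShape π (a , t) (y , z) ×
  ℓ₁ ≡ suc a × ℓ₂ ≡ suc y × ℓ₃ ≡ suc z × ℓ₄ ≡ suc t
lengthVector⇒shape π (a , b , c , a<b , b<c , c≤n , eq , refl , refl , refl , refl)
  -- The strict inequalities leave one unit over, which gives the sizes `suc y` and `suc z`.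
  with y , b≡ ← ≤⇒+ a<b | z , c≡ ← ≤⇒+ b<c | t , refl ← ≤⇒+ c≤n
  with refl ← trans b≡ (sym (+-suc a y))
  with refl ← trans c≡ (sym (+-suc (a + suc y) z)) =
  a , t , y , z ,
  hasShape (oneLine⇒blockSwap (proj₁ π) a (suc y) (suc z) c≤n eq) (shape-total a y z t) ,
  refl , m+n∸m≡n a (suc y) , m+n∸m≡n (a + suc y) (suc z) ,
  trans (∸-cong-suc (a + suc y + suc z) t) (m+n∸m≡n (a + suc y + suc z) (suc t))
  where
  ∸-cong-suc : ∀ c t → suc (c + t) ∸ c ≡ c + suc t ∸ c
  ∸-cong-suc c t = cong (_∸ c) (sym (+-suc c t))

theorem3p5 : (n : ℕ) → 2 ≤ n →
    ((π σ : 𝔅 n) (ℓ₁ ℓ₂ ℓ₃ ℓ₄ m₁ m₂ m₃ m₄ : ℕ) →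
    HasLengthVector π ℓ₁ ℓ₂ ℓ₃ ℓ₄ →
    HasLengthVector σ m₁ m₂ m₃ m₄ →
    IsDistance π σ
    ((∣ ℓ₁ - m₁ ∣ + ∣ ℓ₄ - m₄ ∣) ⊔ (∣ ℓ₂ - m₂ ∣ + ∣ ℓ₃ - m₃ ∣)))
    × HasseConnected n
theorem3p5 n 2≤n = distances , inhabitant , connected
  where
  distances : (π σ : 𝔅 n) (ℓ₁ ℓ₂ ℓ₃ ℓ₄ m₁ m₂ m₃ m₄ : ℕ) →
    HasLengthVector π ℓ₁ ℓ₂ ℓ₃ ℓ₄ → HasLengthVector σ m₁ m₂ m₃ m₄ →
    IsDistance π σ ((∣ ℓ₁ - m₁ ∣ + ∣ ℓ₄ - m₄ ∣) ⊔ (∣ ℓ₂ - m₂ ∣ + ∣ ℓ₃ - m₃ ∣))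
  distances π σ _ _ _ _ _ _ _ _ πℓ σm
    -- All entries are successors, and `∣_-_∣` cancels a common `suc`, so the formula reduces to the
    -- one for the shifted pairs.
    with _ , _ , _ , _ , πs , refl , refl , refl , refl ← lengthVector⇒shape π πℓ
       | _ , _ , _ , _ , σs , refl , refl , refl , refl ← lengthVector⇒shape σ σm = distance πs σs
  inhabitant : 𝔅 n
  -- This is the exchange of the first two entries, two blocks of size 1; it exists because `2 ≤ n`.
  inhabitant = proj₁ (realise (0 , n ∸ 2) (0 , 0)
    (trans (cong (_+ 2) (+-identityʳ (n ∸ 2))) (m∸n+n≡m 2≤n)))
  connected : ∀ (π σ : 𝔅 n) → ∃ λ k → Walk k π σ
  connected π σ =
    let _ , _ , πs = shape π
        _ , _ , σs = shape σ
    in _ , proj₁ (distance πs σs)
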